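{- $$F_{2\text{ - }13}(x,y)=\cfrac{1}{1-\cfrac{x}{1-\cfrac{x}{1-\cfrac{xy}{1-\cfrac{xy}{1-\cfrac{xy^2}{1-\cfrac{xy^2}{1-\ddots}}}}}}},$$ where the successive partial numerators are $x,x,xy,xy,xy^2,xy^2,\dots$, each $xy^i$ ($i\ge 0$) occurring twice.
   Context: An occurrence of the generalized pattern $2\text{ - }13$ in $\pi=\pi_1\cdots\pi_n\in S_n$ is a pair of positions $a<b$ with $b+1\le n$ and $\pi_b<\pi_a<\pi_{b+1}$ (the letters playing the roles of 1 and 3 must be adjacent). A permutation is $1\text{ - }3\text{ - }2$-avoiding if there are no positions $a<b<c$ with $\pi_a<\pi_c<\pi_b$. $f_{\tau;r}(n)$ is the number of $1\text{ - }3\text{ - }2$-avoiding permutations in $S_n$ containing exactly $r$ occurrences of $\tau$ (with $S_0$ consisting of the empty permutation), and $F_\tau(x,y)=\sum_{n,r\ge 0} f_{\tau;r}(n)x^ny^r$, a formal power series in $x$ with coefficients in $\mathbb Z[y]$. The infinite continued fraction is the $x$-adic limit of its finite truncations. -}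

module Defs where

open import Algebra.Bundles.Raw using (RawRing)
import Algebra.Definitions.RawSemiring as RawSemiringDefs
open import Data.Fin.Base as Fin using (Fin; toℕ)
import Data.Fin.Properties as Fin
open import Data.Integer.Base as ℤ using (ℤ)
import Data.Integer.Properties as ℤ
open import Data.List.Base using (List; []; _∷_; length; filter; allFin; cartesianProduct; cartesianProductWith)
open import Data.List.Properties using (filter-none)
import Data.List.Properties as List
import Data.List.Relation.Unary.All as All
open import Data.Nat.Base as ℕ using (ℕ; zero; suc; ⌊_/2⌋)
import Data.Nat.Properties as ℕ
open import Data.Product.Base using (∃; _×_; _,_; proj₁; proj₂)
open import Data.Vec.Base using (Vec; []; _∷_; lookup)
open import Data.Vec.Relation.Unary.AllPairs using (allPairs?)
open import Data.Vec.Relation.Unary.Unique.Propositional using (Unique)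
open import Function.Base using (_∘_)
open import Level using (_⊔_)
open import Relation.Binary.PropositionalEquality
open import Relation.Nullary.Decidable using (¬?; _×-dec_)
open import Relation.Nullary.Negation using (¬_)
open import Relation.Unary using (Decidable)

------------------------------------------------------------------------
-- Formal power series

module PowerSeries {c ℓ} (R : RawRing c ℓ) where

  private module R = RawRing R

  Series : Set c
  Series = ℕ → R.Carrier

  infixl 7 _*_ _/_
  infixl 6 _+_ _-_
  infix  4 _≈_ _⟶_

  _≈_ : Series → Series → Set ℓ
  f ≈ g = ∀ n → f n R.≈ g n

  constant : R.Carrier → Series
  constant a zero    = a
  constant a (suc _) = R.0#

  0ₛ 1ₛ X : Series
  0ₛ = constant R.0#
  1ₛ = constant R.1#
  X zero    = R.0#
  X (suc n) = 1ₛ n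

  _+_ : Series → Series → Series
  (f + g) n = f n R.+ g n

  -_ : Series → Series
  (- f) n = R.- f n

  _-_ : Series → Series → Series
  f - g = f + (- g)

  -- Cauchy product, by f = f₀ + X · (tail of f)
  _*_ : Series → Series → Series
  (f * g) zero    = f 0 R.* g 0
  (f * g) (suc n) = f 0 R.* g (suc n) R.+ ((f ∘ suc) * g) n

  rawRing : RawRing c ℓ
  rawRing = record
    { Carrier = Series ; _≈_ = _≈_ ; _+_ = _+_ ; _*_ = _*_
    ; -_ = -_ ; 0# = 0ₛ ; 1# = 1ₛ }

  -- Long division. This is the quotient of f by g only when g has
  -- constant term 1, see /-correct below.
  _/_ : Series → Series → Series
  (f / g) zero    = f 0
  (f / g) (suc n) = ((λ k → f (suc k) R.+ R.- (f 0 R.* g (suc k))) / g) n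

  -- Convergence in the X-adic topology
  _⟶_ : (ℕ → Series) → Series → Set ℓ
  s ⟶ f = ∀ N → ∃ λ M → ∀ m → M ℕ.≤ m → ∀ n → n ℕ.< N → s m n R.≈ f n

  -- denominator a m = 1 - a₀/(1 - a₁/(⋯ (1 - aₘ₋₁)))
  denominator : (ℕ → Series) → ℕ → Series
  denominator a zero    = 1ₛ
  denominator a (suc m) = 1ₛ - a 0 / denominator (a ∘ suc) m

  truncatedFraction : (ℕ → Series) → ℕ → Series
  truncatedFraction a m = 1ₛ / denominator a m

------------------------------------------------------------------------
-- ℤ[y], as the finitely supported elements of ℤ[[y]]. Equality compares
-- coefficients only and ignores the recorded degree bound.

ℤ-rawRing : RawRing _ _
ℤ-rawRing = ℤ.+-*-rawRing

module ℤ⟦y⟧ = PowerSeries ℤ-rawRing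

VanishesFrom : ℕ → (ℕ → ℤ) → Set
VanishesFrom d f = ∀ k → d ℕ.≤ k → f k ≡ ℤ.0ℤ

record ℤ[y] : Set where
  constructor poly
  field
    coeff         : ℕ → ℤ
    finiteSupport : ∃ λ d → VanishesFrom d coeff

open ℤ[y] public

constant-vanishes : ∀ a → VanishesFrom 1 (ℤ⟦y⟧.constant a)
constant-vanishes a (suc k) _ = refl

constant-0 : ∀ k → ℤ⟦y⟧.constant ℤ.0ℤ k ≡ ℤ.0ℤ
constant-0 zero    = refl
constant-0 (suc _) = refl

y-vanishes : VanishesFrom 2 ℤ⟦y⟧.X
y-vanishes (suc (suc k)) _ = refl
y-vanishes (suc zero) (ℕ.s≤s ())

+-vanishes : ∀ {d e f g} → VanishesFrom d f → VanishesFrom e g →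
             VanishesFrom (d ℕ.+ e) (f ℤ⟦y⟧.+ g)
+-vanishes {d} {e} p q k d+e≤k = cong₂ ℤ._+_
  (p k (ℕ.≤-trans (ℕ.m≤m+n d e) d+e≤k))
  (q k (ℕ.≤-trans (ℕ.m≤n+m e d) d+e≤k))

neg-vanishes : ∀ {d f} → VanishesFrom d f → VanishesFrom d (ℤ⟦y⟧.- f)
neg-vanishes p k d≤k = cong ℤ.-_ (p k d≤k)

0*-vanishes : ∀ {f} g → (∀ k → f k ≡ ℤ.0ℤ) → ∀ k → (f ℤ⟦y⟧.* g) k ≡ ℤ.0ℤ
0*-vanishes g p zero    = cong (ℤ._* g 0) (p 0)
0*-vanishes g p (suc k) = cong₂ ℤ._+_ (cong (ℤ._* g (suc k)) (p 0)) (0*-vanishes g (p ∘ suc) k)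

*-vanishes : ∀ {d e f g} → VanishesFrom d f → VanishesFrom e g →
             VanishesFrom (d ℕ.+ e) (f ℤ⟦y⟧.* g)
*-vanishes {zero}  {g = g} p q k _ = 0*-vanishes g (λ j → p j ℕ.z≤n) k
*-vanishes {suc d} {e} {f} p q (suc k) (ℕ.s≤s d+e≤k) = cong₂ ℤ._+_
  (trans (cong (f 0 ℤ.*_) (q (suc k) (ℕ.m≤n⇒m≤1+n (ℕ.m+n≤o⇒n≤o d d+e≤k)))) (ℤ.*-zeroʳ (f 0)))
  (*-vanishes (λ j d≤j → p (suc j) (ℕ.s≤s d≤j)) q k d+e≤k)

ℤ[y]-rawRing : RawRing _ _
ℤ[y]-rawRing = record
  { Carrier = ℤ[y]
  ; _≈_     = λ p q → coeff p ℤ⟦y⟧.≈ coeff q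
  ; _+_     = λ (poly f (_ , p)) (poly g (_ , q)) → poly (f ℤ⟦y⟧.+ g) (_ , +-vanishes p q)
  ; _*_     = λ (poly f (_ , p)) (poly g (_ , q)) → poly (f ℤ⟦y⟧.* g) (_ , *-vanishes p q)
  ; -_      = λ (poly f (_ , p)) → poly (ℤ⟦y⟧.- f) (_ , neg-vanishes p)
  ; 0#      = poly ℤ⟦y⟧.0ₛ (_ , constant-vanishes _)
  ; 1#      = poly ℤ⟦y⟧.1ₛ (_ , constant-vanishes _)
  }

y : ℤ[y]
y = poly ℤ⟦y⟧.X (_ , y-vanishes)

module ℤ[y]ᴿ = RawRing ℤ[y]-rawRing
open RawSemiringDefs ℤ[y]ᴿ.rawSemiring using (_^_)

------------------------------------------------------------------------
-- ℤ[y][[x]]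

module ℤ[y]⟦x⟧ = PowerSeries ℤ[y]-rawRing
open ℤ[y]⟦x⟧ using (Series; constant; _⟶_; truncatedFraction) public

-- x, x, xy, xy, xy², xy², …
numerator : ℕ → Series
numerator i = ℤ[y]⟦x⟧.X ℤ[y]⟦x⟧.* constant (y ^ ⌊ i /2⌋)

*-monic : ∀ f {g} → g ℤ⟦y⟧.≈ ℤ⟦y⟧.1ₛ → (f ℤ⟦y⟧.* g) ℤ⟦y⟧.≈ f
*-monic f g≈1 zero    = trans (cong (f 0 ℤ.*_) (g≈1 0)) (ℤ.*-identityʳ (f 0))
*-monic f g≈1 (suc n) = trans
  (cong₂ ℤ._+_ (trans (cong (f 0 ℤ.*_) (g≈1 (suc n))) (ℤ.*-zeroʳ (f 0)))
               (*-monic (f ∘ suc) g≈1 n))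
  (ℤ.+-identityˡ (f (suc n)))

cancel : ∀ a b → a ℤ.+ (b ℤ.+ ℤ.- a) ≡ b
cancel a b = trans (ℤ.+-comm a _) (trans (ℤ.+-assoc b (ℤ.- a) a)
  (trans (cong (λ z → b ℤ.+ z) (ℤ.+-inverseˡ a)) (ℤ.+-identityʳ b)))

/-correct : ∀ f g → g 0 ℤ[y]ᴿ.≈ ℤ[y]ᴿ.1# → (f ℤ[y]⟦x⟧./ g) ℤ[y]⟦x⟧.* g ℤ[y]⟦x⟧.≈ f
/-correct f g g₀≈1 zero    = *-monic (coeff (f 0)) g₀≈1
/-correct f g g₀≈1 (suc n) k = trans
  (cong (λ z → coeff (f 0 ℤ[y]ᴿ.* g (suc n)) k ℤ.+ z) (/-correct _ g g₀≈1 n k))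
  (cancel (coeff (f 0 ℤ[y]ᴿ.* g (suc n)) k) (coeff (f (suc n)) k))

-- Hence every quotient occurring in truncatedFraction numerator m is a
-- quotient in ℤ[y][[x]].
denominator-monic : ∀ a → (∀ i → a i 0 ℤ[y]ᴿ.≈ ℤ[y]ᴿ.0#) →
                    ∀ m → ℤ[y]⟦x⟧.denominator a m 0 ℤ[y]ᴿ.≈ ℤ[y]ᴿ.1#
denominator-monic a a₀≈0 zero    k = refl
denominator-monic a a₀≈0 (suc m) k = trans
  (cong (λ z → coeff ℤ[y]ᴿ.1# k ℤ.+ ℤ.- z) (trans (a₀≈0 0 k) (constant-0 k)))
  (ℤ.+-identityʳ (coeff ℤ[y]ᴿ.1# k))

numerator-constantTerm : ∀ i → numerator i 0 ℤ[y]ᴿ.≈ ℤ[y]ᴿ.0#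
numerator-constantTerm i k =
  trans (0*-vanishes (coeff (y ^ ⌊ i /2⌋)) constant-0 k) (sym (constant-0 k))

------------------------------------------------------------------------
-- Permutations and patterns

-- π₁⋯πₙ in one-line notation, with positions and letters counted from 0
Word : ℕ → Set
Word n = Vec (Fin n) n

allVecs : ∀ k n → List (Vec (Fin k) n)
allVecs k zero    = [] ∷ []
allVecs k (suc n) = cartesianProductWith _∷_ (allFin k) (allVecs k n)

unique? : ∀ {k n} → Decidable (Unique {A = Fin k} {n})
unique? = allPairs? λ i j → ¬? (i Fin.≟ j)

-- Permutations are the words with distinct letters; each is listed once.
S : ∀ n → List (Word n)
S n = filter unique? (allVecs n n)

positionPairs : ∀ n → List (Fin n × Fin n)
positionPairs n = cartesianProduct (allFin n) (allFin n)

module _ {n} (π : Word n) where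

  Occurrence132 : Fin n → Fin n → Fin n → Set
  Occurrence132 a b c =
    a Fin.< b × b Fin.< c ×
    lookup π a Fin.< lookup π c × lookup π c Fin.< lookup π b

  Avoids132 : Set
  Avoids132 = ∀ a b c → ¬ Occurrence132 a b c

  Occurrence2-13 : Fin n × Fin n → Set
  Occurrence2-13 (a , b) =
    a Fin.< b × ∃ λ b⁺ → toℕ b⁺ ≡ suc (toℕ b) ×
      lookup π b Fin.< lookup π a × lookup π a Fin.< lookup π b⁺

  occurrence2-13? : Decidable Occurrence2-13
  occurrence2-13? (a , b) =
    a Fin.<? b ×-dec Fin.any? λ b⁺ → toℕ b⁺ ℕ.≟ suc (toℕ b) ×-dec
      lookup π b Fin.<? lookup π a ×-dec lookup π a Fin.<? lookup π b⁺

  occurrences2-13 : ℕ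
  occurrences2-13 = length (filter occurrence2-13? (positionPairs n))

avoids132? : ∀ {n} → Decidable (Avoids132 {n})
avoids132? π = Fin.all? λ a → Fin.all? λ b → Fin.all? λ c → ¬?
  (a Fin.<? b ×-dec b Fin.<? c ×-dec
   lookup π a Fin.<? lookup π c ×-dec lookup π c Fin.<? lookup π b)

f₂₋₁₃ : (r n : ℕ) → ℕ
f₂₋₁₃ r n = length (filter (λ π → avoids132? π ×-dec occurrences2-13 π ℕ.≟ r) (S n))

f₂₋₁₃-vanishes : ∀ n → VanishesFrom (suc (length (positionPairs n))) (λ r → ℤ.+ f₂₋₁₃ r n)
f₂₋₁₃-vanishes n r bound = cong (λ πs → ℤ.+ length πs)
  (filter-none (λ π → avoids132? π ×-dec occurrences2-13 π ℕ.≟ r)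
    (All.universal
      (λ π (_ , occ≡r) → ℕ.<⇒≢ (ℕ.≤-<-trans (List.length-filter (occurrence2-13? π) (positionPairs n)) bound) occ≡r)
      (S n)))

F₂₋₁₃ : Series
F₂₋₁₃ n = poly (λ r → ℤ.+ f₂₋₁₃ r n) (_ , f₂₋₁₃-vanishes n)

{-# OPTIONS --safe #-}

-- A 132-avoiding permutation is L m R with m the maximum and every letter of
-- L above every letter of R. Its occurrences of 2-13 are those in L m and
-- those in R. If A(x) counts 132-avoiding words w by the occurrences of 2-13 in w
-- followed by a new maximum, then
--   F = 1 + x A(x) F  and  A(x) = 1 + x A(x) + xy A(xy) (A(x) - 1),
-- since for nonempty R the new maximum turns each letter of L m into one more
-- occurrence. So F = 1/(1 - x A(x)) and A(x) = 1/(1 - x/(1 - xy A(xy))), and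
-- iterating x ↦ xy unfolds the continued fraction.

module Submission where

open import Defs

open import Algebra.Bundles using (CommutativeRing)
open import Algebra.Definitions.RawSemiring ℤ[y]ᴿ.rawSemiring using (_^_)
import Algebra.Morphism.RingMonomorphism as RingMonomorphism
open import Algebra.Morphism.Structures using (IsRingMonomorphism)
import Algebra.Properties.Semiring.Exp as Exp
open import Algebra.Structures using (IsCommutativeRing)
open import Data.Bool.Base using (if_then_else_)
open import Data.Fin.Base as Fin using (Fin; zero; suc; toℕ; fromℕ<)
import Data.Fin.Properties as Fin
open import Data.Integer.Base as ℤ using (ℤ)
import Data.Integer.Properties as ℤ
open import Data.List.Base as List using
  (List; []; _∷_; [_]; _++_; foldr; map; length; filter; tabulate; allFin; iterate; cartesianProduct)
open import Data.List.Membership.Propositional using (_∈_)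
open import Data.List.Membership.Propositional.Properties using
  (∈-∃++; ∈-++⁺ˡ; ∈-++⁺ʳ; ∈-++⁻; ∈-map⁺; ∈-map⁻; ∈-filter⁺; ∈-filter⁻; ∈-allFin; ∈-lookup; ∈-tabulate⁻;
   ∈-cartesianProduct⁺; ∈-cartesianProduct⁻; ∈-cartesianProductWith⁺)
import Data.List.Properties as List
open import Data.List.Relation.Binary.Permutation.Propositional
  using (_↭_; ↭-refl; ↭-prep; ↭-sym; ↭-trans; ↭-reflexive; ↭⇒↭ₛ)
import Data.List.Relation.Binary.Permutation.Propositional.Properties as ↭
open import Data.List.Relation.Binary.Pointwise using (Pointwise-≡⇒≡)
open import Data.List.Relation.Binary.Subset.Propositional using (_⊆_)
open import Data.List.Relation.Unary.All as All using (All; []; _∷_)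
import Data.List.Relation.Unary.All.Properties as All
open import Data.List.Relation.Unary.AllPairs as AllPairs using (AllPairs; []; _∷_)
import Data.List.Relation.Unary.AllPairs.Properties as AllPairs
open import Data.List.Relation.Unary.Any using (here; there)
open import Data.List.Relation.Unary.Linked.Properties using (AllPairs⇒Linked; Linked⇒AllPairs)
open import Data.List.Relation.Unary.Sorted.TotalOrder.Properties using (↗↭↗⇒≋)
import Data.List.Relation.Unary.Unique.Propositional as List
import Data.List.Relation.Unary.Unique.Propositional.Properties as Unique
open import Data.Nat.Base as ℕ using (ℕ; zero; suc; ⌊_/2⌋)
open import Data.Nat.ListAction using (sum)
open import Data.Nat.ListAction.Properties using (sum-++)
open import Data.Nat.Properties as ℕ using (_<?_; _≟_)
open import Data.List.Sort ℕ.≤-decTotalOrder using (sort; sort-↭; sort-↗)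
open import Data.Nat.Solver using (module +-*-Solver)
open import Data.Product.Base using (_,_; _×_; ∃; proj₁; proj₂; map₁; uncurry)
open import Data.Sum.Base using (inj₁; inj₂)
open import Data.Unit.Base using (⊤; tt)
open import Data.Vec.Base as Vec using (Vec; lookup)
import Data.Vec.Properties as Vec
open import Data.Vec.Relation.Unary.Unique.Propositional using (Unique)
import Data.Vec.Relation.Unary.Unique.Propositional.Properties as VecUnique
open import Function.Base using (_∘_; id)
open import Relation.Binary.Definitions using (tri<; tri≈; tri>)
open import Relation.Binary.PropositionalEquality as ≡ using (_≡_; _≢_; _≗_; refl; cong; cong₂)
open import Relation.Nullary.Decidable using (Dec; yes; no; does; _×-dec_)
open import Relation.Nullary.Negation using (¬_; contradiction)
open import Relation.Unary using (Pred; Decidable)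

-- Power series over a commutative ring

-- The substitution x ↦ xy is never an operation on series: the whole family A(x qⁱ) is defined at
-- once, with the shift i built into the exponent of q, and from it come closed forms for all tails
-- of the fraction. Convergence then reduces to an error estimate: a truncation is wrong only at its
-- innermost level, where 1 replaces 1 - u with u divisible by x, and every level outward has a
-- numerator divisible by x, which gains one order of agreement. The one extra occurrence per letter
-- has this origin: a letter of L m exceeds all of R and lies below the new maximum, so the only
-- adjacent pair after m that it separates is the last letter of R with the new maximum. If R is
-- empty, that pair starts at m, which is not below the letter, and nothing is gained.

module SeriesRing {c ℓ} (R : CommutativeRing c ℓ) where

  private
    module R = CommutativeRing R
    module P = PowerSeries R.rawRing
  open P hiding (Series; constant; _⟶_; truncatedFraction)
  open import Relation.Binary.Reasoning.Setoid R.setoid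
  open import Algebra.Solver.Ring.NaturalCoefficients.Default R.commutativeSemiring
    using (solve; _:=_; _:+_; _:*_)
  open import Algebra.Properties.AbelianGroup R.+-abelianGroup using (xyx⁻¹≈y; ε⁻¹≈ε)

  *-cong : ∀ {f f′ g g′} → f ≈ f′ → g ≈ g′ → f * g ≈ f′ * g′
  *-cong p q zero    = R.*-cong (p 0) (q 0)
  *-cong p q (suc n) = R.+-cong (R.*-cong (p 0) (q (suc n))) (*-cong (p ∘ suc) q n)

  -- The product is defined by peeling the left factor; the induction for commutativity also needs
  -- to peel the right one.
  *-suc : ∀ f g n → (f * g) (suc n) R.≈ (f * (g ∘ suc)) n R.+ f (suc n) R.* g 0
  *-suc f g zero    = R.refl
  *-suc f g (suc n) = begin
    f 0 R.* g (suc (suc n)) R.+ ((f ∘ suc) * g) (suc n)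
      ≈⟨ R.+-congˡ (*-suc (f ∘ suc) g n) ⟩
    f 0 R.* g (suc (suc n)) R.+ (((f ∘ suc) * (g ∘ suc)) n R.+ f (suc (suc n)) R.* g 0)
      ≈⟨ R.+-assoc _ _ _ ⟨
    (f * (g ∘ suc)) (suc n) R.+ f (suc (suc n)) R.* g 0 ∎

  *-comm : ∀ f g → f * g ≈ g * f
  *-comm f g zero    = R.*-comm (f 0) (g 0)
  *-comm f g (suc n) = begin
    f 0 R.* g (suc n) R.+ ((f ∘ suc) * g) n  ≈⟨ R.+-cong (R.*-comm _ _) (*-comm (f ∘ suc) g n) ⟩
    g (suc n) R.* f 0 R.+ (g * (f ∘ suc)) n  ≈⟨ R.+-comm _ _ ⟩
    (g * (f ∘ suc)) n R.+ g (suc n) R.* f 0  ≈⟨ *-suc g f n ⟨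
    (g * f) (suc n)                          ∎

  *-distribʳ : ∀ f g h → (g + h) * f ≈ g * f + h * f
  *-distribʳ f g h zero    = R.distribʳ (f 0) (g 0) (h 0)
  *-distribʳ f g h (suc n) = begin
    (g 0 R.+ h 0) R.* f (suc n) R.+ ((g ∘ suc + h ∘ suc) * f) n
      ≈⟨ R.+-congˡ (*-distribʳ f (g ∘ suc) (h ∘ suc) n) ⟩
    (g 0 R.+ h 0) R.* f (suc n) R.+ (((g ∘ suc) * f) n R.+ ((h ∘ suc) * f) n)
      ≈⟨ solve 5 (λ a b c d e → (a :+ b) :* c :+ (d :+ e) := (a :* c :+ d) :+ (b :* c :+ e))
           R.refl (g 0) (h 0) (f (suc n)) (((g ∘ suc) * f) n) (((h ∘ suc) * f) n) ⟩
    (g * f) (suc n) R.+ (h * f) (suc n) ∎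

  scale-* : ∀ a g h n → ((λ k → a R.* g k) * h) n R.≈ a R.* (g * h) n
  scale-* a g h zero    = R.*-assoc a (g 0) (h 0)
  scale-* a g h (suc n) = begin
    a R.* g 0 R.* h (suc n) R.+ ((λ k → a R.* g (suc k)) * h) n
      ≈⟨ R.+-cong (R.*-assoc _ _ _) (scale-* a (g ∘ suc) h n) ⟩
    a R.* (g 0 R.* h (suc n)) R.+ a R.* ((g ∘ suc) * h) n
      ≈⟨ R.distribˡ _ _ _ ⟨
    a R.* (g * h) (suc n) ∎

  *-assoc : ∀ f g h → (f * g) * h ≈ f * (g * h)
  *-assoc f g h zero    = R.*-assoc (f 0) (g 0) (h 0)
  *-assoc f g h (suc n) = begin
    f 0 R.* g 0 R.* h (suc n) R.+ (((λ k → f 0 R.* g (suc k)) + (f ∘ suc) * g) * h) n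
      ≈⟨ R.+-cong (R.*-assoc _ _ _) (*-distribʳ h (λ k → f 0 R.* g (suc k)) ((f ∘ suc) * g) n) ⟩
    f 0 R.* (g 0 R.* h (suc n)) R.+ (((λ k → f 0 R.* g (suc k)) * h) n R.+ (((f ∘ suc) * g) * h) n)
      ≈⟨ R.+-congˡ (R.+-cong (scale-* (f 0) (g ∘ suc) h n) (*-assoc (f ∘ suc) g h n)) ⟩
    f 0 R.* (g 0 R.* h (suc n)) R.+ (f 0 R.* ((g ∘ suc) * h) n R.+ ((f ∘ suc) * (g * h)) n)
      ≈⟨ solve 4 (λ a b c d → a :* b :+ (a :* c :+ d) := a :* (b :+ c) :+ d)
           R.refl (f 0) (g 0 R.* h (suc n)) (((g ∘ suc) * h) n) (((f ∘ suc) * (g * h)) n) ⟩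
    (f * (g * h)) (suc n) ∎

  0*-≈ : ∀ {f} g → (∀ n → f n R.≈ R.0#) → ∀ n → (f * g) n R.≈ R.0#
  0*-≈ g p zero    = R.trans (R.*-congʳ (p 0)) (R.zeroˡ _)
  0*-≈ g p (suc n) =
    R.trans (R.+-cong (R.trans (R.*-congʳ (p 0)) (R.zeroˡ _)) (0*-≈ g (p ∘ suc) n)) (R.+-identityˡ _)

  constant-* : ∀ a f n → (P.constant a * f) n R.≈ a R.* f n
  constant-* a f zero    = R.refl
  constant-* a f (suc n) =
    R.trans (R.+-congˡ (0*-≈ {P.constant a ∘ suc} f (λ _ → R.refl) n)) (R.+-identityʳ _)

  *-identityˡ : ∀ f → 1ₛ * f ≈ f
  *-identityˡ f n = R.trans (constant-* R.1# f n) (R.*-identityˡ (f n))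

  0ₛ≈0 : ∀ n → 0ₛ n R.≈ R.0#
  0ₛ≈0 zero    = R.refl
  0ₛ≈0 (suc n) = R.refl

  X-* : ∀ f n → (X * f) (suc n) R.≈ f n
  X-* f n = R.trans (R.+-cong (R.zeroˡ _) (*-identityˡ f n)) (R.+-identityˡ _)

  private
    +-identityˡ : ∀ f → 0ₛ + f ≈ f
    +-identityˡ f n = R.trans (R.+-congʳ (0ₛ≈0 n)) (R.+-identityˡ _)

    -‿inverseˡ : ∀ f → (- f) + f ≈ 0ₛ
    -‿inverseˡ f n = R.trans (R.-‿inverseˡ _) (R.sym (0ₛ≈0 n))

    +-comm : ∀ f g → f + g ≈ g + f
    +-comm f g n = R.+-comm _ _

  isCommutativeRing : IsCommutativeRing _≈_ _+_ _*_ -_ 0ₛ 1ₛ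
  isCommutativeRing = record
    { isRing = record
      { +-isAbelianGroup = record
        { isGroup = record
          { isMonoid = record
            { isSemigroup = record
              { isMagma = record
                { isEquivalence = record
                  { refl  = λ _ → R.refl
                  ; sym   = λ p n → R.sym (p n)
                  ; trans = λ p q n → R.trans (p n) (q n)
                  }
                ; ∙-cong = λ p q n → R.+-cong (p n) (q n)
                }
              ; assoc = λ f g h n → R.+-assoc _ _ _
              }
            ; identity = +-identityˡ , λ f n → R.trans (+-comm f 0ₛ n) (+-identityˡ f n)
            }
          ; inverse = -‿inverseˡ , λ f n → R.trans (+-comm f (- f) n) (-‿inverseˡ f n)
          ; ⁻¹-cong = λ p n → R.-‿cong (p n)
          }
        ; comm = +-comm
        }
      ; *-cong = *-cong
      ; *-assoc = *-assoc
      ; *-identity = *-identityˡ , λ f n → R.trans (*-comm f 1ₛ n) (*-identityˡ f n)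
      ; distrib = (λ f g h n → R.trans (*-comm f (g + h) n) (R.trans (*-distribʳ f g h n)
                    (R.+-cong (*-comm g f n) (*-comm h f n)))) , *-distribʳ
      }
    ; *-comm = *-comm
    }

  commutativeRing : CommutativeRing c ℓ
  commutativeRing = record { isCommutativeRing = isCommutativeRing }

  infix 4 _≈[_]_
  _≈[_]_ : P.Series → ℕ → P.Series → Set ℓ
  f ≈[ N ] g = ∀ n → n ℕ.< N → f n R.≈ g n

  -- Coefficient n of a long division reads its arguments only up to index n; each step drops the
  -- head of the remainder, so the bound N falls with it.
  /-cong : ∀ N {f f′ g g′} → f ≈[ N ] f′ → g ≈[ N ] g′ → f / g ≈[ N ] f′ / g′
  /-cong (suc N) p q zero    n<N = p 0 n<N
  /-cong (suc N) {f} {f′} {g} {g′} p q (suc n) (ℕ.s≤s n<N) = /-cong N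
    (λ k k<N → R.+-cong (p (suc k) (ℕ.s≤s k<N))
      (R.-‿cong (R.*-cong (p 0 ℕ.z<s) (q (suc k) (ℕ.s≤s k<N)))))
    (λ k k<N → q k (ℕ.m<n⇒m<1+n k<N)) n n<N

  -- A numerator without constant term gains one order of agreement.
  /-congʳ-gain : ∀ N {f g g′} → f 0 R.≈ R.0# → g ≈[ N ] g′ → f / g ≈[ suc N ] f / g′
  /-congʳ-gain N f₀≈0 q zero    _ = R.refl
  /-congʳ-gain N {f} {g} {g′} f₀≈0 q (suc n) (ℕ.s≤s n<N) = /-cong N
    (λ k _ → R.+-congˡ (R.-‿cong (R.trans (f₀*≈0 (g (suc k))) (R.sym (f₀*≈0 (g′ (suc k)))))))
    q n n<N
    where
    f₀*≈0 : ∀ a → f 0 R.* a R.≈ R.0#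
    f₀*≈0 a = R.trans (R.*-congʳ f₀≈0) (R.zeroˡ a)

  -- The monic denominator forces the head of `h` to be `f 0`; removing it leaves the same equation
  -- for the tail of `h`, with the long-division remainder as numerator.
  /-unique : ∀ {h g f} → h * g ≈ f → g 0 R.≈ R.1# → h ≈ f / g
  /-unique {h} {g} {f} hg≈f g₀≈1 zero = begin
    h 0           ≈⟨ R.*-identityʳ _ ⟨
    h 0 R.* R.1#  ≈⟨ R.*-congˡ g₀≈1 ⟨
    h 0 R.* g 0   ≈⟨ hg≈f 0 ⟩
    f 0           ∎
  /-unique {h} {g} {f} hg≈f g₀≈1 (suc n) = /-unique {h ∘ suc} {g} tail g₀≈1 n
    where
    tail : (h ∘ suc) * g ≈ λ k → f (suc k) R.+ R.- (f 0 R.* g (suc k))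
    tail k = begin
      ((h ∘ suc) * g) k
        ≈⟨ xyx⁻¹≈y (h 0 R.* g (suc k)) _ ⟨
      (h * g) (suc k) R.+ R.- (h 0 R.* g (suc k))
        ≈⟨ R.+-cong (hg≈f (suc k)) (R.-‿cong (R.*-congʳ (/-unique {h} hg≈f g₀≈1 0))) ⟩
      f (suc k) R.+ R.- (f 0 R.* g (suc k)) ∎

  /-*-cancel : ∀ f {g} → g 0 R.≈ R.1# → (f / g) * g ≈ f
  /-*-cancel f {g} g₀≈1 zero    = R.trans (R.*-congˡ g₀≈1) (R.*-identityʳ _)
  /-*-cancel f {g} g₀≈1 (suc n) = begin
    f 0 R.* g (suc n) R.+ (((f / g) ∘ suc) * g) n
      ≈⟨ R.+-congˡ (/-*-cancel _ {g} g₀≈1 n) ⟩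
    f 0 R.* g (suc n) R.+ (f (suc n) R.- f 0 R.* g (suc n))
      ≈⟨ R.+-assoc _ _ _ ⟨
    f 0 R.* g (suc n) R.+ f (suc n) R.- f 0 R.* g (suc n)
      ≈⟨ xyx⁻¹≈y _ _ ⟩
    f (suc n) ∎

  1-monic : ∀ {u} → u 0 R.≈ R.0# → (1ₛ - u) 0 R.≈ R.1#
  1-monic u₀≈0 = R.trans (R.+-congˡ (R.-‿cong u₀≈0)) (R.trans (R.+-congˡ ε⁻¹≈ε) (R.+-identityʳ _))

  -- u i is the tail a i / (1 - a (i + 1) / (1 - ⋯)) of the infinite fraction.
  Tails : (a u : ℕ → P.Series) → Set ℓ
  Tails a u = ∀ i → a i 0 R.≈ R.0# × u i 0 R.≈ R.0# × u i * (1ₛ - u (suc i)) ≈ a i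

  -- At depth 0 the truncation has 1 in place of `1ₛ - u 0`, correct to order 1 because `u 0` has no
  -- constant term. Each further level gains one order by `/-congʳ-gain`.
  denominator-agrees : ∀ m {a u} → Tails a u → denominator a m ≈[ suc m ] 1ₛ - u 0
  denominator-agrees zero    {u = u} tails zero    _ = R.sym (1-monic {u 0} (proj₁ (proj₂ (tails 0))))
  denominator-agrees zero    tails (suc n) (ℕ.s≤s ())
  denominator-agrees (suc m) {a} {u} tails n n<2+m =
    let a₀≈0 , _ , u-tail = tails 0 in
    R.+-congˡ (R.-‿cong (R.trans
      (/-congʳ-gain (suc m) {a 0} {denominator (a ∘ suc) m} {1ₛ - u 1} a₀≈0
        (denominator-agrees m (tails ∘ suc)) n n<2+m)
      (R.sym (/-unique {u 0} {1ₛ - u 1} {a 0} u-tail (1-monic {u 1} (proj₁ (proj₂ (tails 1)))) n))))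

  truncatedFraction-⟶ : ∀ {a u f} → Tails a u → f * (1ₛ - u 0) ≈ 1ₛ → P.truncatedFraction a P.⟶ f
  -- Depth m is accurate to order m + 1, so the witness M = N suffices.
  truncatedFraction-⟶ {a} {u} {f} tails f*≈1 N = N , λ m N≤m n n<N → R.trans
    (/-cong N {1ₛ} {1ₛ} (λ _ _ → R.refl)
      (λ k k<N → denominator-agrees m tails k (ℕ.m<n⇒m<1+n (ℕ.<-≤-trans k<N N≤m))) n n<N)
    (R.sym (/-unique {f} {1ₛ - u 0} {1ₛ} f*≈1 (1-monic {u 0} (proj₁ (proj₂ (tails 0)))) n))

-- Equations of the form x (1 - y) = z in a commutative ring

module _ {c ℓ} (R : CommutativeRing c ℓ) where

  open CommutativeRing R
  open import Relation.Binary.Reasoning.Setoid setoid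
  open import Algebra.Solver.Ring.NaturalCoefficients.Default commutativeSemiring
    using (solve; _:=_; _:+_; _:*_; con)
  open import Algebra.Properties.Ring ring using (-‿distribʳ-*; +-cancelʳ)
  open import Algebra.Properties.AbelianGroup +-abelianGroup using (//-rightDividesˡ; //-rightDividesʳ)

  private
    expand : ∀ x y → x * (1# - y) ≈ x - x * y
    expand x y = trans (distribˡ x 1# (- y)) (+-cong (*-identityʳ x) (sym (-‿distribʳ-* x y)))

  -- This and its converse trade the subtraction for a sum, which brings the remaining identities
  -- within reach of the semiring solver.
  *-1-⇒ : ∀ {x y z} → x * (1# - y) ≈ z → x ≈ z + x * y
  *-1-⇒ {x} {y} {z} p = begin
    x                  ≈⟨ //-rightDividesˡ (x * y) x ⟨
    x - x * y + x * y  ≈⟨ +-congʳ (expand x y) ⟨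
    x * (1# - y) + x * y ≈⟨ +-congʳ p ⟩
    z + x * y          ∎

  *-1-⇐ : ∀ {x y z} → x ≈ z + x * y → x * (1# - y) ≈ z
  *-1-⇐ {x} {y} {z} p = begin
    x * (1# - y)       ≈⟨ expand x y ⟩
    x - x * y          ≈⟨ +-congʳ p ⟩
    z + x * y - x * y  ≈⟨ //-rightDividesʳ (x * y) z ⟩
    z                  ∎

  -- a = 1 + ca + w(a - 1) says a = 1/(1 - c/(1 - w)).
  two-levels : ∀ {a b c w} → a + w ≈ 1# + c * a + w * a → b * (1# - w) ≈ 1# → a * (1# - c * b) ≈ 1#
  -- Since b = 1 + bw, the added summand bw(a + 1) completes a to b(a + w), where `p` applies; the
  -- same summand reappears on the right and cancels.
  two-levels {a} {b} {c} {w} p q = *-1-⇐ (+-cancelʳ (b * w * (a + 1#)) a (1# + a * (c * b)) (begin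
    a + b * w * (a + 1#)                 ≈⟨ solve 2 (λ a d → a :+ d :* (a :+ con 1) := (con 1 :+ d) :* a :+ d)
           (CommutativeRing.refl R) a (b * w) ⟩
    (1# + b * w) * a + b * w             ≈⟨ +-congʳ (*-congʳ b≈) ⟨
    b * a + b * w                        ≈⟨ distribˡ b a w ⟨
    b * (a + w)                          ≈⟨ *-congˡ p ⟩
    b * (1# + c * a + w * a)
      ≈⟨ solve 4 (λ a b c w → b :* (con 1 :+ c :* a :+ w :* a) := b :+ (a :* (c :* b) :+ b :* w :* a))
           (CommutativeRing.refl R) a b c w ⟩
    b + (a * (c * b) + b * w * a)        ≈⟨ +-congʳ b≈ ⟩
    1# + b * w + (a * (c * b) + b * w * a)
      ≈⟨ solve 3 (λ a d e → con 1 :+ d :+ (e :+ d :* a) := con 1 :+ e :+ d :* (a :+ con 1))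
           (CommutativeRing.refl R) a (b * w) (a * (c * b)) ⟩
    1# + a * (c * b) + b * w * (a + 1#)  ∎))
    where
    b≈ : b ≈ 1# + b * w
    b≈ = *-1-⇒ q

-- The polynomials in y as a commutative ring

ℤ⟦y⟧-commutativeRing : CommutativeRing _ _
ℤ⟦y⟧-commutativeRing = SeriesRing.commutativeRing ℤ.+-*-commutativeRing

-- Equality in ℤ[y] is defined through coefficients, so injectivity is the identity and the ring
-- laws can be pulled back from ℤ[[y]].
coeff-isRingMonomorphism : IsRingMonomorphism ℤ[y]-rawRing ℤ⟦y⟧.rawRing coeff
coeff-isRingMonomorphism = record
  { isRingHomomorphism = record
    { isSemiringHomomorphism = record
      { isNearSemiringHomomorphism = record
        { +-isMonoidHomomorphism = record
          { isMagmaHomomorphism = record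
            { isRelHomomorphism = record { cong = id }
            ; homo = λ _ _ _ → refl
            }
          ; ε-homo = λ _ → refl
          }
        ; *-homo = λ _ _ _ → refl
        }
      ; 1#-homo = λ _ → refl
      }
    ; -‿homo = λ _ _ → refl
    }
  ; injective = id
  }

ℤ[y]-commutativeRing : CommutativeRing _ _
ℤ[y]-commutativeRing = record
  { isCommutativeRing = RingMonomorphism.isCommutativeRing coeff-isRingMonomorphism
      (CommutativeRing.isCommutativeRing ℤ⟦y⟧-commutativeRing) }

-- Generating functions of trees

-- The tree `node l r` stands for L m R. No letters are stored: as L lies above R, the sizes
-- determine them.
data Tree : Set where
  leaf : Tree
  node : (l r : Tree) → Tree

size : Tree → ℕ
size leaf       = 0
size (node l r) = suc (size l ℕ.+ size r)

-- The number of occurrences of 2-13 in the word of a tree with a new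
-- maximum appended.
occurrences⁺ : Tree → ℕ
occurrences⁺ leaf                  = 0
occurrences⁺ (node l leaf)         = occurrences⁺ l
occurrences⁺ (node l r@(node _ _)) = occurrences⁺ l ℕ.+ suc (size l) ℕ.+ occurrences⁺ r

-- The root is itself a new maximum placed after L, hence `occurrences⁺` on the left.
occurrences : Tree → ℕ
occurrences leaf       = 0
occurrences (node l r) = occurrences⁺ l ℕ.+ occurrences r

module _ {a b} {A : Set a} {B : Set b} where

  -- Recursion in the same shape as the Cauchy product, so that sums over it become products of
  -- series by a direct induction.
  convolve : (ℕ → List A) → (ℕ → List B) → ℕ → List (A × B)
  convolve f g zero    = cartesianProduct (f 0) (g 0)
  convolve f g (suc n) = cartesianProduct (f 0) (g (suc n)) ++ convolve (f ∘ suc) g n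

  convolve-cong : ∀ n {f f′ g g′} → (∀ i → i ℕ.≤ n → f i ≡ f′ i) → (∀ i → i ℕ.≤ n → g i ≡ g′ i) →
                  convolve f g n ≡ convolve f′ g′ n
  convolve-cong zero    p q = cong₂ cartesianProduct (p 0 ℕ.z≤n) (q 0 ℕ.z≤n)
  convolve-cong (suc n) p q = cong₂ _++_
    (cong₂ cartesianProduct (p 0 ℕ.z≤n) (q (suc n) ℕ.≤-refl))
    (convolve-cong n (λ i i≤n → p (suc i) (ℕ.s≤s i≤n)) (λ i i≤n → q i (ℕ.m≤n⇒m≤1+n i≤n)))

-- The first argument is fuel.
treesOfSize : ℕ → ℕ → List Tree
treesOfSize _       zero    = [ leaf ]
treesOfSize zero    (suc n) = []
treesOfSize (suc h) (suc n) = map (uncurry node) (convolve (treesOfSize h) (treesOfSize h) n)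

-- Fuel beyond the size changes nothing; this gives `trees` a recurrence free of fuel.
treesOfSize-cong : ∀ {h h′} n → n ℕ.≤ h → n ℕ.≤ h′ → treesOfSize h n ≡ treesOfSize h′ n
treesOfSize-cong zero    _ _ = refl
treesOfSize-cong (suc n) (ℕ.s≤s n≤h) (ℕ.s≤s n≤h′) =
  cong (map (uncurry node)) (convolve-cong n agree agree)
  where
  agree : ∀ i → i ℕ.≤ n → treesOfSize _ i ≡ treesOfSize _ i
  agree i i≤n = treesOfSize-cong i (ℕ.≤-trans i≤n n≤h) (ℕ.≤-trans i≤n n≤h′)

trees : ℕ → List Tree
trees n = treesOfSize n n

trees-suc : ∀ n → trees (suc n) ≡ map (uncurry node) (convolve trees trees n)
trees-suc n = cong (map (uncurry node)) (convolve-cong n agree agree)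
  where
  agree : ∀ i → i ℕ.≤ n → treesOfSize n i ≡ trees i
  agree i i≤n = treesOfSize-cong i i≤n ℕ.≤-refl

-- Ring-valued sums over lists

module ListSum {c ℓ} (R : CommutativeRing c ℓ) where

  open CommutativeRing R hiding (refl)
  private
    module R = CommutativeRing R
    module P = PowerSeries rawRing
  open import Relation.Binary.Reasoning.Setoid setoid
  open import Algebra.Solver.Ring.NaturalCoefficients.Default commutativeSemiring
    using (solve; _:=_; _:+_)

  ∑ : ∀ {a} {A : Set a} → (A → Carrier) → List A → Carrier
  ∑ p = foldr (λ x s → p x + s) 0#

  module _ {a} {A : Set a} where

    ∑-cong : ∀ {p q : A → Carrier} → (∀ x → p x ≈ q x) → ∀ xs → ∑ p xs ≈ ∑ q xs
    ∑-cong p≈q []       = R.refl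
    ∑-cong p≈q (x ∷ xs) = +-cong (p≈q x) (∑-cong p≈q xs)

    ∑-++ : ∀ (p : A → Carrier) xs ys → ∑ p (xs ++ ys) ≈ ∑ p xs + ∑ p ys
    ∑-++ p []       ys = sym (+-identityˡ _)
    ∑-++ p (x ∷ xs) ys = trans (+-congˡ (∑-++ p xs ys)) (sym (+-assoc _ _ _))

    ∑-+ : ∀ (p q : A → Carrier) xs → ∑ (λ x → p x + q x) xs ≈ ∑ p xs + ∑ q xs
    ∑-+ p q []       = sym (+-identityˡ _)
    ∑-+ p q (x ∷ xs) = begin
      p x + q x + ∑ (λ x → p x + q x) xs  ≈⟨ +-congˡ (∑-+ p q xs) ⟩
      p x + q x + (∑ p xs + ∑ q xs)
        ≈⟨ solve 4 (λ a b c d → a :+ b :+ (c :+ d) := a :+ c :+ (b :+ d)) R.refl (p x) (q x) (∑ p xs) (∑ q xs) ⟩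
      p x + ∑ p xs + (q x + ∑ q xs)       ∎

    ∑-scale : ∀ a (p : A → Carrier) xs → ∑ (λ x → a * p x) xs ≈ a * ∑ p xs
    ∑-scale a p []       = sym (zeroʳ a)
    ∑-scale a p (x ∷ xs) = trans (+-congˡ (∑-scale a p xs)) (sym (distribˡ a _ _))

    ∑-0 : ∀ xs → ∑ (λ (_ : A) → 0#) xs ≈ 0#
    ∑-0 []       = R.refl
    ∑-0 (x ∷ xs) = trans (+-identityˡ _) (∑-0 xs)

    ∑-map : ∀ {b} {B : Set b} (p : A → Carrier) (f : B → A) xs → ∑ p (map f xs) ≡ ∑ (p ∘ f) xs
    ∑-map p f []       = refl
    ∑-map p f (x ∷ xs) = cong (p (f x) +_) (∑-map p f xs)

  module _ {a b} {A : Set a} {B : Set b} (p : A → Carrier) (q : B → Carrier) where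

    private
      pq : A × B → Carrier
      pq (x , y) = p x * q y

    ∑-cartesianProduct : ∀ xs ys → ∑ pq (cartesianProduct xs ys) ≈ ∑ p xs * ∑ q ys
    ∑-cartesianProduct []       ys = sym (zeroˡ _)
    ∑-cartesianProduct (x ∷ xs) ys = begin
      ∑ pq (map (x ,_) ys ++ cartesianProduct xs ys)            ≈⟨ ∑-++ pq (map (x ,_) ys) _ ⟩
      ∑ pq (map (x ,_) ys) + ∑ pq (cartesianProduct xs ys)
        ≈⟨ +-cong (trans (reflexive (∑-map pq (x ,_) ys)) (∑-scale (p x) q ys)) (∑-cartesianProduct xs ys) ⟩
      p x * ∑ q ys + ∑ p xs * ∑ q ys                            ≈⟨ distribʳ _ _ _ ⟨
      (p x + ∑ p xs) * ∑ q ys                                   ∎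

    ∑-convolve : ∀ f g n → ∑ pq (convolve f g n) ≈ ((∑ p ∘ f) P.* (∑ q ∘ g)) n
    ∑-convolve f g zero    = ∑-cartesianProduct (f 0) (g 0)
    ∑-convolve f g (suc n) = trans (∑-++ pq (cartesianProduct (f 0) (g (suc n))) _)
      (+-cong (∑-cartesianProduct (f 0) (g (suc n))) (∑-convolve (f ∘ suc) g n))

-- Each numerator occurs twice, so the tails of the fraction come from two families taken
-- alternately; swapping the arguments produces the alternation.
interleave : ∀ {a} {A : Set a} → (ℕ → A) → (ℕ → A) → ℕ → A
interleave f g zero    = f 0
interleave f g (suc j) = interleave g (f ∘ suc) j

interleave-diagonal : ∀ {a} {A : Set a} (f : ℕ → A) j → interleave f f j ≡ f ⌊ j /2⌋
interleave-diagonal f zero          = refl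
interleave-diagonal f (suc zero)    = refl
interleave-diagonal f (suc (suc j)) = interleave-diagonal (f ∘ suc) j

interleave-steps : ∀ {a b p} {A : Set a} {B : Set b} (P : A → A → B → Set p) {f g h k} →
                   (∀ i → P (f i) (g i) (h i)) → (∀ i → P (g i) (f (suc i)) (k i)) →
                   ∀ j → P (interleave f g j) (interleave f g (suc j)) (interleave h k j)
interleave-steps P p q zero    = p 0
interleave-steps P p q (suc j) = interleave-steps P q (p ∘ suc) j

-- Functional equations and the tails of the fraction

module TreeSeries {c ℓ} (R : CommutativeRing c ℓ) (q : CommutativeRing.Carrier R) where

  private
    module R = CommutativeRing R
    module S = CommutativeRing (SeriesRing.commutativeRing R)
    module P = PowerSeries R.rawRing
    module PR = SeriesRing R
  open ListSum R
  open Exp R.semiring using (^-homo-*) renaming (_^_ to _↑_)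
  open import Algebra.Solver.Ring.NaturalCoefficients.Default S.commutativeSemiring
    using (solve; _:=_; _:+_; _:*_; con)

  -- Replacing x by x qⁱ gives every node of the tree a further factor qⁱ.
  weight : ℕ → Tree → ℕ
  weight i t = occurrences⁺ t ℕ.+ size t ℕ.* i

  isLeaf : Tree → R.Carrier
  isLeaf leaf       = R.1#
  isLeaf (node _ _) = R.0#

  -- Summed over trees this gives A(x qⁱ) - 1 without a subtraction, as `isLeaf` gives 1.
  nodeWeight : ℕ → Tree → R.Carrier
  nodeWeight i leaf         = R.0#
  nodeWeight i t@(node _ _) = q ↑ weight i t

  module _ where
    open import Relation.Binary.Reasoning.Setoid R.setoid
    open +-*-Solver renaming (solve to solveℕ; _:+_ to _⊕_; _:*_ to _⊗_; _:=_ to _⊜_; con to κ)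

    -- The two summands separate empty from nonempty right subtrees. A nonempty one adds 1 +
    -- `size l` to the exponent: `size l` moves `l` from level i to level i + 1, and the 1 turns the
    -- factor qⁱ of the root into that of level i + 1.
    weight-node : ∀ i l r → q ↑ weight i (node l r) R.≈
      q ↑ i R.* (q ↑ weight i l R.* isLeaf r) R.+ q ↑ suc i R.* (q ↑ weight (suc i) l R.* nodeWeight i r)
    weight-node i l leaf = begin
      q ↑ weight i (node l leaf)
        ≡⟨ cong (q ↑_) (solveℕ 3 (λ a s i → a ⊕ (κ 1 ⊕ (s ⊕ κ 0)) ⊗ i ⊜ i ⊕ (a ⊕ s ⊗ i))
             refl (occurrences⁺ l) (size l) i) ⟩
      q ↑ (i ℕ.+ weight i l)                         ≈⟨ ^-homo-* q i (weight i l) ⟩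
      q ↑ i R.* q ↑ weight i l                       ≈⟨ R.*-congˡ (R.*-identityʳ _) ⟨
      q ↑ i R.* (q ↑ weight i l R.* R.1#)            ≈⟨ R.+-identityʳ _ ⟨
      q ↑ i R.* (q ↑ weight i l R.* R.1#) R.+ R.0#
        ≈⟨ R.+-congˡ (R.trans (R.*-congˡ (R.zeroʳ _)) (R.zeroʳ _)) ⟨
      q ↑ i R.* (q ↑ weight i l R.* R.1#) R.+ q ↑ suc i R.* (q ↑ weight (suc i) l R.* R.0#) ∎
    weight-node i l r@(node _ _) = begin
      q ↑ weight i (node l r)
        ≡⟨ cong (q ↑_) (solveℕ 5 (λ a s b t i → a ⊕ (κ 1 ⊕ s) ⊕ b ⊕ (κ 1 ⊕ (s ⊕ t)) ⊗ i ⊜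
             (κ 1 ⊕ i) ⊕ ((a ⊕ s ⊗ (κ 1 ⊕ i)) ⊕ (b ⊕ t ⊗ i)))
             refl (occurrences⁺ l) (size l) (occurrences⁺ r) (size r) i) ⟩
      q ↑ (suc i ℕ.+ (weight (suc i) l ℕ.+ weight i r))
        ≈⟨ ^-homo-* q (suc i) _ ⟩
      q ↑ suc i R.* q ↑ (weight (suc i) l ℕ.+ weight i r)
        ≈⟨ R.*-congˡ (^-homo-* q (weight (suc i) l) _) ⟩
      q ↑ suc i R.* (q ↑ weight (suc i) l R.* q ↑ weight i r)
        ≈⟨ R.+-identityˡ _ ⟨
      R.0# R.+ q ↑ suc i R.* (q ↑ weight (suc i) l R.* q ↑ weight i r)
        ≈⟨ R.+-congʳ (R.trans (R.*-congˡ (R.zeroʳ _)) (R.zeroʳ _)) ⟨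
      q ↑ i R.* (q ↑ weight i l R.* R.0#) R.+ q ↑ suc i R.* (q ↑ weight (suc i) l R.* q ↑ weight i r) ∎

  -- For q = `y`, `level ⌊ j /2⌋` unfolds to `numerator j`, so the limit found here is literally the
  -- one in the theorem.
  level : ℕ → P.Series
  level i = P.X P.* P.constant (q ↑ i)

  level-*-suc : ∀ i f n → (level i P.* f) (suc n) R.≈ q ↑ i R.* f n
  level-*-suc i f n = R.trans (PR.*-assoc P.X (P.constant (q ↑ i)) f (suc n))
    (R.trans (PR.X-* (P.constant (q ↑ i) P.* f) n) (PR.constant-* (q ↑ i) f n))

  level-*-0 : ∀ i f → (level i P.* f) 0 R.≈ R.0#
  level-*-0 i f = R.trans (R.*-congʳ (R.zeroˡ _)) (R.zeroˡ _)

  -- 𝔸 i is A(x qⁱ) for the generating function A of trees by occurrences⁺.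
  𝔸 : ℕ → P.Series
  𝔸 i n = ∑ (λ t → q ↑ weight i t) (trees n)

  𝔽 : P.Series
  𝔽 n = ∑ (λ t → q ↑ occurrences t) (trees n)

  private
    𝔸⁺ : ℕ → P.Series
    𝔸⁺ i n = ∑ (nodeWeight i) (trees n)

    ∑-isLeaf : (∑ isLeaf ∘ trees) P.≈ P.1ₛ
    ∑-isLeaf zero    = R.+-identityʳ _
    ∑-isLeaf (suc n) = R.trans (R.reflexive (∑-map isLeaf (uncurry node) splits)) (∑-0 splits)
      where splits = convolve (treesOfSize n) (treesOfSize n) n

    𝔸≈1+𝔸⁺ : ∀ i → 𝔸 i P.≈ P.1ₛ P.+ 𝔸⁺ i
    𝔸≈1+𝔸⁺ i zero    = R.+-congˡ (R.sym (R.+-identityˡ _))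
    𝔸≈1+𝔸⁺ i (suc n) = R.trans
      (R.reflexive (≡.trans (∑-map _ (uncurry node) splits) (≡.sym (∑-map (nodeWeight i) (uncurry node) splits))))
      (R.sym (R.+-identityˡ _))
      where splits = convolve (treesOfSize n) (treesOfSize n) n

    ∑-trees-suc : ∀ p n → ∑ p (trees (suc n)) ≡ ∑ (p ∘ uncurry node) (convolve trees trees n)
    ∑-trees-suc p n = ≡.trans (cong (∑ p) (trees-suc n)) (∑-map p (uncurry node) (convolve trees trees n))

  𝔸-recurrence : ∀ i → 𝔸 i P.≈ P.1ₛ P.+ level i P.* 𝔸 i P.+ level (suc i) P.* (𝔸 (suc i) P.* 𝔸⁺ i)
  𝔸-recurrence i zero = R.trans (R.sym (R.+-identityʳ _))
    (R.sym (R.+-cong (R.+-congˡ (level-*-0 i (𝔸 i))) (level-*-0 (suc i) (𝔸 (suc i) P.* 𝔸⁺ i))))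
  𝔸-recurrence i (suc n) = begin
    𝔸 i (suc n)
      ≡⟨ ∑-trees-suc _ n ⟩
    ∑ (λ (l , r) → q ↑ weight i (node l r)) splits
      ≈⟨ ∑-cong (λ (l , r) → weight-node i l r) splits ⟩
    ∑ (λ (l , r) → q ↑ i R.* (q ↑ weight i l R.* isLeaf r) R.+
                   q ↑ suc i R.* (q ↑ weight (suc i) l R.* nodeWeight i r)) splits
      ≈⟨ ∑-+ _ _ splits ⟩
    ∑ (λ (l , r) → q ↑ i R.* (q ↑ weight i l R.* isLeaf r)) splits R.+
    ∑ (λ (l , r) → q ↑ suc i R.* (q ↑ weight (suc i) l R.* nodeWeight i r)) splits
      ≈⟨ R.+-cong (∑-scale (q ↑ i) _ splits) (∑-scale (q ↑ suc i) _ splits) ⟩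
    q ↑ i R.* ∑ (λ (l , r) → q ↑ weight i l R.* isLeaf r) splits R.+
    q ↑ suc i R.* ∑ (λ (l , r) → q ↑ weight (suc i) l R.* nodeWeight i r) splits
      ≈⟨ R.+-cong
           (R.*-congˡ (R.trans (∑-convolve _ _ trees trees n)
             (R.trans (PR.*-cong {𝔸 i} (λ _ → R.refl) ∑-isLeaf n) (S.*-identityʳ (𝔸 i) n))))
           (R.*-congˡ (∑-convolve _ _ trees trees n)) ⟩
    q ↑ i R.* 𝔸 i n R.+ q ↑ suc i R.* (𝔸 (suc i) P.* 𝔸⁺ i) n
      ≈⟨ R.+-cong (R.trans (R.+-identityˡ _) (level-*-suc i (𝔸 i) n)) (level-*-suc (suc i) _ n) ⟨
    (P.1ₛ P.+ level i P.* 𝔸 i P.+ level (suc i) P.* (𝔸 (suc i) P.* 𝔸⁺ i)) (suc n) ∎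
    where
    open import Relation.Binary.Reasoning.Setoid R.setoid
    splits = convolve trees trees n

  -- The form that `two-levels` expects: adding w on the left absorbs the -1 of A - 1.
  𝔸-equation : ∀ i → let w = level (suc i) P.* 𝔸 (suc i) in
               𝔸 i P.+ w P.≈ P.1ₛ P.+ level i P.* 𝔸 i P.+ w P.* 𝔸 i
  𝔸-equation i = begin
    𝔸 i P.+ v P.* 𝔸 (suc i)
      ≈⟨ S.+-congʳ {v P.* 𝔸 (suc i)} (𝔸-recurrence i) ⟩
    P.1ₛ P.+ u P.* 𝔸 i P.+ v P.* (𝔸 (suc i) P.* 𝔸⁺ i) P.+ v P.* 𝔸 (suc i)
      ≈⟨ solve 4 (λ k v b a⁺ → k :+ v :* (b :* a⁺) :+ v :* b := k :+ v :* b :* (con 1 :+ a⁺))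
           S.refl (P.1ₛ P.+ u P.* 𝔸 i) v (𝔸 (suc i)) (𝔸⁺ i) ⟩
    P.1ₛ P.+ u P.* 𝔸 i P.+ v P.* 𝔸 (suc i) P.* (P.1ₛ P.+ 𝔸⁺ i)
      ≈⟨ S.+-congˡ {P.1ₛ P.+ u P.* 𝔸 i} (S.*-congˡ {v P.* 𝔸 (suc i)} (𝔸≈1+𝔸⁺ i)) ⟨
    P.1ₛ P.+ u P.* 𝔸 i P.+ v P.* 𝔸 (suc i) P.* 𝔸 i ∎
    where
    open import Relation.Binary.Reasoning.Setoid S.setoid
    u = level i
    v = level (suc i)

  𝔽-recurrence : 𝔽 P.≈ P.1ₛ P.+ level 0 P.* (𝔸 0 P.* 𝔽)
  𝔽-recurrence zero    = R.+-congˡ (R.sym (level-*-0 0 (𝔸 0 P.* 𝔽)))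
  𝔽-recurrence (suc n) = begin
    𝔽 (suc n)
      ≡⟨ ∑-trees-suc _ n ⟩
    ∑ (λ (l , r) → q ↑ (occurrences⁺ l ℕ.+ occurrences r)) splits
      ≈⟨ ∑-cong (λ (l , r) → R.trans (^-homo-* q (occurrences⁺ l) (occurrences r))
           (R.*-congʳ (R.reflexive (cong (q ↑_) (weight-0 l))))) splits ⟩
    ∑ (λ (l , r) → q ↑ weight 0 l R.* q ↑ occurrences r) splits
      ≈⟨ ∑-convolve _ _ trees trees n ⟩
    (𝔸 0 P.* 𝔽) n
      ≈⟨ R.trans (R.+-identityˡ _) (R.trans (level-*-suc 0 (𝔸 0 P.* 𝔽) n) (R.*-identityˡ _)) ⟨
    (P.1ₛ P.+ level 0 P.* (𝔸 0 P.* 𝔽)) (suc n) ∎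
    where
    open import Relation.Binary.Reasoning.Setoid R.setoid
    splits = convolve trees trees n
    weight-0 : ∀ t → occurrences⁺ t ≡ weight 0 t
    weight-0 t = ≡.sym (≡.trans (cong (occurrences⁺ t ℕ.+_) (ℕ.*-zeroʳ (size t))) (ℕ.+-identityʳ _))

  𝔽-equation : 𝔽 P.* (P.1ₛ P.- level 0 P.* 𝔸 0) P.≈ P.1ₛ
  𝔽-equation = *-1-⇐ (SeriesRing.commutativeRing R) {𝔽} {level 0 P.* 𝔸 0} {P.1ₛ}
    (S.trans {𝔽} 𝔽-recurrence (S.+-congˡ {P.1ₛ}
      (solve 3 (λ c a f → c :* (a :* f) := f :* (c :* a)) S.refl (level 0) (𝔸 0) 𝔽)))

  -- The intermediate level of the fraction: `two-levels` shows that 𝔸 i is 1/(1 - `level i` · 𝔹 i).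
  𝔹 : ℕ → P.Series
  𝔹 i = P.1ₛ P./ (P.1ₛ P.- level (suc i) P.* 𝔸 (suc i))

  level-0 : ∀ i → level i 0 R.≈ R.0#
  level-0 i = R.zeroˡ _

  𝔹-equation : ∀ i → 𝔹 i P.* (P.1ₛ P.- level (suc i) P.* 𝔸 (suc i)) P.≈ P.1ₛ
  𝔹-equation i = PR./-*-cancel P.1ₛ {P.1ₛ P.- level (suc i) P.* 𝔸 (suc i)}
    (PR.1-monic {level (suc i) P.* 𝔸 (suc i)} (level-*-0 (suc i) (𝔸 (suc i))))

  private
    Step : P.Series → P.Series → P.Series → Set ℓ
    Step u v a = a 0 R.≈ R.0# × u 0 R.≈ R.0# × u P.* (P.1ₛ P.- v) P.≈ a

  -- Tails of even index are `level i` times 𝔸 i, where the step is `two-levels`; those of odd index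
  -- are `level i` times 𝔹 i, where it is the definition of 𝔹.
  fraction-steps : PR.Tails (λ j → level ⌊ j /2⌋) (interleave (λ i → level i P.* 𝔸 i) (λ i → level i P.* 𝔹 i))
  fraction-steps j = ≡.subst (Step _ _) (interleave-diagonal level j) (interleave-steps Step
    (λ i → level-0 i , level-*-0 i (𝔸 i) ,
       S.trans {level i P.* 𝔸 i P.* (P.1ₛ P.- level i P.* 𝔹 i)} (PR.*-assoc (level i) (𝔸 i) _)
         (S.trans {level i P.* (𝔸 i P.* (P.1ₛ P.- level i P.* 𝔹 i))}
           (S.*-congˡ {level i} (two-levels (SeriesRing.commutativeRing R)
             {𝔸 i} {𝔹 i} {level i} {level (suc i) P.* 𝔸 (suc i)} (𝔸-equation i) (𝔹-equation i)))
           (S.*-identityʳ (level i))))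
    (λ i → level-0 i , level-*-0 i (𝔹 i) ,
       S.trans {level i P.* 𝔹 i P.* (P.1ₛ P.- level (suc i) P.* 𝔸 (suc i))} (PR.*-assoc (level i) (𝔹 i) _)
         (S.trans {level i P.* (𝔹 i P.* (P.1ₛ P.- level (suc i) P.* 𝔸 (suc i)))}
           (S.*-congˡ {level i} (𝔹-equation i)) (S.*-identityʳ (level i))))
    j)

  fraction-⟶𝔽 : P.truncatedFraction (λ j → level ⌊ j /2⌋) P.⟶ 𝔽
  fraction-⟶𝔽 = PR.truncatedFraction-⟶ fraction-steps 𝔽-equation

-- 132-avoiding words as trees

open import Data.Nat.Base using (_+_; _*_; _≤_; _<_; z≤n; s≤s; z<s)
open ≡ using (sym; trans; subst; subst₂; module ≡-Reasoning)

𝟙 : ∀ {p} {P : Set p} → Dec P → ℕ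
𝟙 P? = if does P? then 1 else 0

𝟙-yes : ∀ {p} {P : Set p} (P? : Dec P) → P → 𝟙 P? ≡ 1
𝟙-yes (yes _) _ = refl
𝟙-yes (no ¬p) p = contradiction p ¬p

𝟙-no : ∀ {p} {P : Set p} (P? : Dec P) → ¬ P → 𝟙 P? ≡ 0
𝟙-no (yes p) ¬p = contradiction p ¬p
𝟙-no (no _)  _  = refl

-- With x as the 2, this counts the adjacent pairs that can serve as 13.
straddles : ℕ → List ℕ → ℕ
straddles x []                = 0
straddles x (u ∷ [])          = 0
straddles x (u ∷ vs@(v ∷ _)) = 𝟙 (u <? x ×-dec x <? v) + straddles x vs

count2-13 : List ℕ → ℕ
count2-13 []       = 0
count2-13 (x ∷ xs) = straddles x xs + count2-13 xs

-- The letter `m` is kept in both parts, as it belongs to an adjacent pair on either side.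
straddles-++ : ∀ x us m vs → straddles x (us ++ m ∷ vs) ≡ straddles x (us ++ [ m ]) + straddles x (m ∷ vs)
straddles-++ x []            m vs = refl
straddles-++ x (u ∷ [])      m vs = cong (_+ straddles x (m ∷ vs)) (sym (ℕ.+-identityʳ _))
straddles-++ x (u ∷ us@(v ∷ _)) m vs =
  trans (cong (𝟙 (u <? x ×-dec x <? v) +_) (straddles-++ x us m vs)) (sym (ℕ.+-assoc (𝟙 (u <? x ×-dec x <? v)) _ _))

straddles-∷ : ∀ {x u} vs → x ≤ u → straddles x (u ∷ vs) ≡ straddles x vs
straddles-∷ []       x≤u = refl
straddles-∷ {x} {u} (v ∷ vs) x≤u =
  cong (_+ straddles x (v ∷ vs)) (𝟙-no (u <? x ×-dec x <? v) λ (u<x , _) → ℕ.<⇒≱ u<x x≤u)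

straddles-below : ∀ {x us} → All (_≤ x) us → straddles x us ≡ 0
straddles-below []          = refl
straddles-below (_ ∷ [])    = refl
straddles-below {x} {u ∷ v ∷ _} (_ ∷ ps@(v≤x ∷ _)) =
  cong₂ _+_ (𝟙-no (u <? x ×-dec x <? v) λ (_ , x<v) → ℕ.<⇒≱ x<v v≤x) (straddles-below ps)

-- Only the last letter of `us` with `m` separates x: this is the single extra occurrence, and the
-- reason why the right part must be nonempty.
straddles-below-max : ∀ {x m us} → All (_< x) us → 0 < length us → x < m → straddles x (us ++ [ m ]) ≡ 1
straddles-below-max {x} {m} {u ∷ []} (u<x ∷ []) _ x<m =
  cong (_+ 0) (𝟙-yes (u <? x ×-dec x <? m) (u<x , x<m))
straddles-below-max {x} {m} {u ∷ v ∷ _} (_ ∷ ps@(v<x ∷ _)) _ x<m =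
  cong₂ _+_ (𝟙-no (u <? x ×-dec x <? v) λ (_ , x<v) → ℕ.<-asym x<v v<x) (straddles-below-max ps z<s x<m)

module _ where
  open +-*-Solver

  -- Every letter of L sees the same number k of straddling pairs from m onward: 1 when a nonempty R
  -- and a new maximum follow m, 0 in the other two uses.
  count2-13-++ : ∀ {k us m vs} → All (λ x → straddles x (m ∷ vs) ≡ k) us →
    count2-13 (us ++ m ∷ vs) ≡ count2-13 (us ++ [ m ]) + length us * k + count2-13 (m ∷ vs)
  count2-13-++ [] = refl
  count2-13-++ {k} {x ∷ us} {m} {vs} (p ∷ ps) = begin
    straddles x (us ++ m ∷ vs) + count2-13 (us ++ m ∷ vs)
      ≡⟨ cong₂ _+_ (trans (straddles-++ x us m vs) (cong (straddles x (us ++ [ m ]) +_) p)) (count2-13-++ ps) ⟩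
    straddles x (us ++ [ m ]) + k + (count2-13 (us ++ [ m ]) + length us * k + count2-13 (m ∷ vs))
      ≡⟨ solve 5 (λ s k c l d → s :+ k :+ (c :+ l :* k :+ d) := s :+ c :+ (k :+ l :* k) :+ d) refl
           (straddles x (us ++ [ m ])) k (count2-13 (us ++ [ m ])) (length us) (count2-13 (m ∷ vs)) ⟩
    count2-13 (x ∷ us ++ [ m ]) + length (x ∷ us) * k + count2-13 (m ∷ vs) ∎
    where open ≡-Reasoning

-- The letters of word k t are k, …, k + size t - 1, and the maximum sits at
-- the root.
word : ℕ → Tree → List ℕ
word k leaf       = []
word k (node l r) = word (k + size r) l ++ (k + (size l + size r)) ∷ word k r

length-word : ∀ k t → length (word k t) ≡ size t
length-word k leaf       = refl
length-word k (node l r) = begin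
  length (word (k + size r) l ++ _ ∷ word k r)            ≡⟨ List.length-++ (word (k + size r) l) ⟩
  length (word (k + size r) l) + suc (length (word k r))
    ≡⟨ cong₂ (λ a b → a + suc b) (length-word _ l) (length-word k r) ⟩
  size l + suc (size r)                                   ≡⟨ ℕ.+-suc _ _ ⟩
  suc (size l + size r)                                   ∎
  where open ≡-Reasoning

word-≥ : ∀ k t → All (k ≤_) (word k t)
word-≥ k leaf       = []
word-≥ k (node l r) = All.++⁺ (All.map (ℕ.≤-trans (ℕ.m≤m+n k (size r))) (word-≥ _ l))
  (ℕ.m≤m+n k _ ∷ word-≥ k r)

root-letter : ∀ k l r → k + size r + size l ≡ k + (size l + size r)
root-letter k l r = trans (ℕ.+-assoc k (size r) (size l)) (cong (k +_) (ℕ.+-comm (size r) (size l)))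

word-< : ∀ k t → All (_< k + size t) (word k t)
word-left-< : ∀ k l r → All (_< k + (size l + size r)) (word (k + size r) l)
word-right-< : ∀ k l r → All (_< k + (size l + size r)) (word k r)

word-< k leaf       = []
word-< k (node l r) rewrite ℕ.+-suc k (size l + size r) = All.++⁺
  (All.map ℕ.m<n⇒m<1+n (word-left-< k l r)) (ℕ.≤-refl ∷ All.map ℕ.m<n⇒m<1+n (word-right-< k l r))

word-left-< k l r =
  subst (λ b → All (_< b) (word (k + size r) l)) (root-letter k l r) (word-< (k + size r) l)

word-right-< k l r = All.map (λ x< → ℕ.<-≤-trans x< (ℕ.+-monoʳ-≤ k (ℕ.m≤n+m (size r) (size l)))) (word-< k r)

word-right<left : ∀ k l r → All (λ x → All (_< x) (word k r)) (word (k + size r) l)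
word-right<left k l r =
  All.map (λ k+r≤x → All.map (λ z< → ℕ.<-≤-trans z< k+r≤x) (word-< k r)) (word-≥ (k + size r) l)

-- The bound on `m` is an inequality because the right subtree is treated with the same `m`,
-- although its own letters stop lower.
count2-13-word⁺ : ∀ k t {m} → k + size t ≤ m → count2-13 (word k t ++ [ m ]) ≡ occurrences⁺ t
count2-13-word⁺ k leaf          k+n≤m = refl
count2-13-word⁺ k (node l leaf) {m} k+n≤m = begin
  count2-13 ((us ++ [ b ]) ++ [ m ])                            ≡⟨ cong count2-13 (List.++-assoc us [ b ] [ m ]) ⟩
  count2-13 (us ++ b ∷ [ m ])
    ≡⟨ count2-13-++ (All.map (straddles-∷ [ m ] ∘ ℕ.<⇒≤) (word-left-< k l leaf)) ⟩
  count2-13 (us ++ [ b ]) + length us * 0 + 0                   ≡⟨ ℕ.+-identityʳ _ ⟩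
  count2-13 (us ++ [ b ]) + length us * 0
    ≡⟨ cong (count2-13 (us ++ [ b ]) +_) (ℕ.*-zeroʳ (length us)) ⟩
  count2-13 (us ++ [ b ]) + 0                                   ≡⟨ ℕ.+-identityʳ _ ⟩
  count2-13 (us ++ [ b ])
    ≡⟨ count2-13-word⁺ (k + 0) l (ℕ.≤-reflexive (root-letter k l leaf)) ⟩
  occurrences⁺ l                                                ∎
  where
  open ≡-Reasoning
  us = word (k + 0) l
  b  = k + (size l + 0)
count2-13-word⁺ k (node l r@(node _ _)) {m} k+n≤m = begin
  count2-13 ((us ++ b ∷ vs) ++ [ m ])                           ≡⟨ cong count2-13 (List.++-assoc us (b ∷ vs) [ m ]) ⟩
  count2-13 (us ++ b ∷ vs ++ [ m ])
    ≡⟨ count2-13-++ (All.zipWith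
         (λ (x<b , vs<x) → trans (straddles-∷ (vs ++ [ m ]) (ℕ.<⇒≤ x<b))
                                 (straddles-below-max vs<x 0<|vs| (ℕ.<-trans x<b b<m)))
         (word-left-< k l r , word-right<left k l r)) ⟩
  -- Each letter of L gains one occurrence and the root gains one: together the `suc (size l)` of
  -- `occurrences⁺`.
  count2-13 (us ++ [ b ]) + length us * 1 + (straddles b (vs ++ [ m ]) + count2-13 (vs ++ [ m ]))
    ≡⟨ cong₂ _+_
         (cong₂ _+_ (count2-13-word⁺ (k + size r) l (ℕ.≤-reflexive (root-letter k l r)))
           (trans (ℕ.*-identityʳ _) (length-word _ l)))
         (cong₂ _+_ (straddles-below-max (word-right-< k l r) 0<|vs| b<m)
           (count2-13-word⁺ k r (ℕ.≤-trans (ℕ.+-monoʳ-≤ k (ℕ.m≤n+m (size r) (size l))) (ℕ.<⇒≤ b<m)))) ⟩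
  occurrences⁺ l + size l + suc (occurrences⁺ r)                ≡⟨ ℕ.+-suc _ _ ⟩
  suc (occurrences⁺ l + size l + occurrences⁺ r)                ≡⟨ cong (_+ occurrences⁺ r) (ℕ.+-suc _ _) ⟨
  occurrences⁺ l + suc (size l) + occurrences⁺ r                ∎
  where
  open ≡-Reasoning
  us = word (k + size r) l
  vs = word k r
  b  = k + (size l + size r)
  b<m : b < m
  b<m = subst (_≤ m) (ℕ.+-suc k _) k+n≤m
  0<|vs| : 0 < length vs
  0<|vs| = subst (0 <_) (sym (length-word k r)) z<s

-- With no new maximum, nothing after the root rises above a letter of L, so L and R contribute
-- independently.
count2-13-word : ∀ k t → count2-13 (word k t) ≡ occurrences t
count2-13-word k leaf       = refl
count2-13-word k (node l r) = begin
  count2-13 (us ++ b ∷ vs)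
    ≡⟨ count2-13-++ (All.zipWith
         (λ (x<b , vs<x) → trans (straddles-∷ vs (ℕ.<⇒≤ x<b)) (straddles-below (All.map ℕ.<⇒≤ vs<x)))
         (word-left-< k l r , word-right<left k l r)) ⟩
  count2-13 (us ++ [ b ]) + length us * 0 + (straddles b vs + count2-13 vs)
    ≡⟨ cong₂ _+_
         (cong₂ _+_ (count2-13-word⁺ (k + size r) l (ℕ.≤-reflexive (root-letter k l r)))
           (ℕ.*-zeroʳ (length us)))
         (cong₂ _+_ (straddles-below (All.map ℕ.<⇒≤ (word-right-< k l r))) (count2-13-word k r)) ⟩
  occurrences⁺ l + 0 + occurrences r                            ≡⟨ cong (_+ occurrences r) (ℕ.+-identityʳ _) ⟩
  occurrences⁺ l + occurrences r                                ∎
  where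
  open ≡-Reasoning
  us = word (k + size r) l
  vs = word k r
  b  = k + (size l + size r)

word-unique : ∀ k t → List.Unique (word k t)
word-unique k leaf       = []
word-unique k (node l r) = AllPairs.++⁺ (word-unique _ l)
  (All.map (λ x<b b≡x → ℕ.<⇒≢ x<b (sym b≡x)) (word-right-< k l r) ∷ word-unique k r)
  (All.zipWith (λ (x<b , vs<x) → ℕ.<⇒≢ x<b ∷ All.map (λ z<x x≡z → ℕ.<⇒≢ z<x (sym x≡z)) vs<x)
    (word-left-< k l r , word-right<left k l r))

-- On either side `m` is the first letter that is not below `m`, which fixes the cut.
++-∷-injective : ∀ {m us us′ vs vs′} → All (_< m) us → All (_< m) us′ →
                 us ++ m ∷ vs ≡ us′ ++ m ∷ vs′ → us ≡ us′ × vs ≡ vs′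
++-∷-injective []       []        eq = refl , List.∷-injectiveʳ eq
++-∷-injective []       (m<m ∷ _) eq = contradiction (sym (List.∷-injectiveˡ eq)) (ℕ.<⇒≢ m<m)
++-∷-injective (m<m ∷ _) []       eq = contradiction (List.∷-injectiveˡ eq) (ℕ.<⇒≢ m<m)
++-∷-injective (_ ∷ ps) (_ ∷ ps′) eq =
  let us≡ , vs≡ = ++-∷-injective ps ps′ (List.∷-injectiveʳ eq) in
  cong₂ _∷_ (List.∷-injectiveˡ eq) us≡ , vs≡

word-injective : ∀ k t t′ → word k t ≡ word k t′ → t ≡ t′
word-size-injective : ∀ {k t t′} → word k t ≡ word k t′ → size t ≡ size t′
word-size-injective {k} {t} {t′} eq = trans (sym (length-word k t)) (trans (cong length eq) (length-word k t′))

word-injective k leaf leaf _ = refl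
word-injective k leaf t′@(node _ _) eq = contradiction (word-size-injective {k} {leaf} {t′} eq) λ ()
word-injective k t@(node _ _) leaf  eq = contradiction (word-size-injective {k} {t} {leaf} eq) λ ()
word-injective k t@(node l r) t′@(node l′ r′) eq =
  cong₂ node
    (word-injective _ l l′ (trans us≡ (cong (λ n → word (k + n) l′) (sym |r|≡))))
    (word-injective k r r′ vs≡)
  where
  -- Equal lengths give equal root letters, so both words can be cut at the root; the right parts
  -- then have equal size, which aligns the offsets of the left parts.
  |t|≡ : size l + size r ≡ size l′ + size r′
  |t|≡ = ℕ.suc-injective (word-size-injective {k} {t} {t′} eq)
  parts = ++-∷-injective (word-left-< k l r)
    (subst (λ n → All (_< k + n) (word (k + size r′) l′)) (sym |t|≡) (word-left-< k l′ r′))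
    (trans eq (cong (λ n → word (k + size r′) l′ ++ (k + n) ∷ word k r′) (sym |t|≡)))
  us≡ = proj₁ parts
  vs≡ = proj₂ parts
  |r|≡ : size r ≡ size r′
  |r|≡ = word-size-injective {k} {r} {r′} vs≡

-- Avoidance of 132 and recovery of the tree from its word

Avoids1 : ℕ → List ℕ → Set
Avoids1 x = AllPairs λ b c → ¬ (x < c × c < b)

Avoids : List ℕ → Set
Avoids []       = ⊤
Avoids (x ∷ xs) = Avoids1 x xs × Avoids xs

≤⇒avoids1 : ∀ {x xs} → All (_≤ x) xs → Avoids1 x xs
≤⇒avoids1 []           = []
≤⇒avoids1 (_ ∷ xs≤x) = All.map (λ c≤x (x<c , _) → ℕ.<⇒≱ x<c c≤x) xs≤x ∷ ≤⇒avoids1 xs≤x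

-- A 132 that starts in `us` cannot end at the maximum `m`, nor in `vs`, which lies below `us`; one
-- that starts at `m` finds nothing larger.
avoids-++ : ∀ {us m vs} → All (_< m) us → All (_< m) vs → All (λ x → All (_< x) vs) us →
            Avoids us → Avoids vs → Avoids (us ++ m ∷ vs)
avoids-++ []  vs<m []   _ vs-avoids = ≤⇒avoids1 (All.map ℕ.<⇒≤ vs<m) , vs-avoids
avoids-++ {x ∷ us} {m} {vs} (x<m ∷ us<m) vs<m (vs<x ∷ vs<us) (x-us , us-avoids) vs-avoids =
  AllPairs.++⁺ x-us
    (All.map (λ c<x (x<c , _) → ℕ.<-asym c<x x<c) vs<x ∷ ≤⇒avoids1 (All.map ℕ.<⇒≤ vs<x))
    (All.map (λ b<m → (λ (_ , m<b) → ℕ.<-asym b<m m<b) ∷ All.map (λ c<x (x<c , _) → ℕ.<-asym c<x x<c) vs<x) us<m)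
  , avoids-++ us<m vs<m vs<us us-avoids vs-avoids

word-avoids : ∀ k t → Avoids (word k t)
word-avoids k leaf       = tt
word-avoids k (node l r) =
  avoids-++ (word-left-< k l r) (word-right-< k l r) (word-right<left k l r) (word-avoids _ l) (word-avoids k r)

module _ {a p} {A : Set a} {R : A → A → Set p} where

  allPairs-++⁻ : ∀ xs {ys} → AllPairs R (xs ++ ys) → AllPairs R xs × AllPairs R ys
  allPairs-++⁻ []       ps       = [] , ps
  allPairs-++⁻ (x ∷ xs) (p ∷ ps) = map₁ (All.++⁻ˡ xs p ∷_) (allPairs-++⁻ xs ps)

-- With `m` as the 3, a letter before it and a larger one after it would form a 132.
avoids-++⁻ : ∀ us {m vs} → All (_< m) vs → Avoids (us ++ m ∷ vs) →
             Avoids us × Avoids vs × All (λ x → All (_≤ x) vs) us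
avoids-++⁻ []       vs<m (_ , vs-avoids) = tt , vs-avoids , []
avoids-++⁻ (x ∷ us) vs<m (x-avoids , avoids) =
  let us-avoids , vs-avoids , vs≤us = avoids-++⁻ us vs<m avoids
      x-us , x-m∷vs = allPairs-++⁻ us x-avoids
  in (x-us , us-avoids) , vs-avoids ,
     All.zipWith (λ (¬p , c<m) → ℕ.≮⇒≥ λ x<c → ¬p (x<c , c<m)) (AllPairs.head x-m∷vs , vs<m) ∷ vs≤us

range : ℕ → ℕ → List ℕ
range = iterate suc

range-++ : ∀ k m n → range k (m + n) ≡ range k m ++ range (k + m) n
range-++ k zero    n = cong (λ j → range j n) (sym (ℕ.+-identityʳ k))
range-++ k (suc m) n = cong (k ∷_) (trans (range-++ (suc k) m n)
  (cong (λ j → range (suc k) m ++ range j n) (sym (ℕ.+-suc k m))))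

range-snoc : ∀ k n → range k (suc n) ≡ range k n ++ [ k + n ]
range-snoc k n = trans (cong (range k) (ℕ.+-comm 1 n)) (range-++ k n 1)

range-≥ : ∀ k n → All (k ≤_) (range k n)
range-≥ k zero    = []
range-≥ k (suc n) = ℕ.≤-refl ∷ All.map ℕ.<⇒≤ (range-≥ (suc k) n)

range-< : ∀ k n → All (_< k + n) (range k n)
range-< k zero    = []
range-< k (suc n) rewrite ℕ.+-suc k n = s≤s (ℕ.m≤m+n k n) ∷ range-< (suc k) n

range-sorted : ∀ k n → AllPairs _≤_ (range k n)
range-sorted k zero    = []
range-sorted k (suc n) = All.map ℕ.<⇒≤ (range-≥ (suc k) n) ∷ range-sorted (suc k) n

++-injective : ∀ {us us′ vs vs′ : List ℕ} → length us ≡ length us′ → us ++ vs ≡ us′ ++ vs′ → us ≡ us′ × vs ≡ vs′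
++-injective {[]}     {[]}     _ eq = refl , eq
++-injective {_ ∷ us} {_ ∷ us′} p eq =
  let us≡ , vs≡ = ++-injective {us} {us′} (ℕ.suc-injective p) (List.∷-injectiveʳ eq) in
  cong₂ _∷_ (List.∷-injectiveˡ eq) us≡ , vs≡

-- Sorting each block and putting `vs` first gives a sorted rearrangement of the range. That
-- rearrangement is unique, so cutting the range at the length of `vs` yields the two blocks.
range-split : ∀ k us vs → us ++ vs ↭ range k (length us + length vs) → All (λ x → All (_≤ x) vs) us →
              us ↭ range (k + length vs) (length us) × vs ↭ range k (length vs)
range-split k us vs us++vs↭ vs≤us =
  ↭-trans (↭-sym (sort-↭ us)) (↭-reflexive (proj₂ parts)) , ↭-trans (↭-sym (sort-↭ vs)) (↭-reflexive (proj₁ parts))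
  where
  sorted : AllPairs _≤_ (sort vs ++ sort us)
  sorted = AllPairs.++⁺ (Linked⇒AllPairs ℕ.≤-trans (sort-↗ vs)) (Linked⇒AllPairs ℕ.≤-trans (sort-↗ us))
    (All.tabulate λ z∈ → All.tabulate λ x∈ →
      All.lookup (All.lookup vs≤us (↭.∈-resp-↭ (sort-↭ us) x∈)) (↭.∈-resp-↭ (sort-↭ vs) z∈))
  sorted≡ : sort vs ++ sort us ≡ range k (length vs + length us)
  sorted≡ = Pointwise-≡⇒≡ (↗↭↗⇒≋ ℕ.≤-totalOrder (AllPairs⇒Linked sorted) (AllPairs⇒Linked (range-sorted k _))
    (↭⇒↭ₛ (↭-trans (↭.++⁺ (sort-↭ vs) (sort-↭ us)) (↭-trans (↭.++-comm vs us)
      (↭-trans us++vs↭ (↭-reflexive (cong (range k) (ℕ.+-comm (length us) (length vs)))))))))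
  parts : sort vs ≡ range k (length vs) × sort us ≡ range (k + length vs) (length us)
  parts = ++-injective (trans (↭.↭-length (sort-↭ vs)) (sym (List.length-iterate suc k (length vs))))
    (trans sorted≡ (range-++ k (length vs) (length us)))

range-max : ∀ k n → k + n ∈ range k (suc n)
range-max k n = subst (k + n ∈_) (sym (range-snoc k n)) (∈-++⁺ʳ (range k n) (here refl))

-- The first argument is fuel.
parse : ∀ h {k n w} → n ≤ h → w ↭ range k n → Avoids w → ∃ λ t → size t ≡ n × word k t ≡ w
parse h       {n = zero}          _         w↭ _ = leaf , refl , sym (↭.↭-empty-inv w↭)
parse (suc h) {k} {suc n} {w} (s≤s n≤h) w↭ w-avoids
  with us , vs , refl ← ∈-∃++ (↭.∈-resp-↭ (↭-sym w↭) (range-max k n)) =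
  let tₗ , |tₗ| , wordₗ = parse h (ℕ.≤-trans (ℕ.m≤m+n _ _) |w|≤h) (proj₁ split) (proj₁ avoid)
      tᵣ , |tᵣ| , wordᵣ = parse h (ℕ.≤-trans (ℕ.m≤n+m _ _) |w|≤h) (proj₂ split) (proj₁ (proj₂ avoid))
      |t| = cong₂ _+_ |tₗ| |tᵣ|
  in node tₗ tᵣ , cong suc (trans |t| |w|) ,
     cong₂ _++_ (trans (cong (λ j → word (k + j) tₗ) |tᵣ|) wordₗ)
       (cong₂ _∷_ (cong (k +_) (trans |t| |w|)) wordᵣ)
  where
  us++vs↭ : us ++ vs ↭ range k n
  us++vs↭ = ↭-trans (↭.drop-mid us (range k n) (↭-trans w↭ (↭-reflexive (range-snoc k n))))
    (↭-reflexive (List.++-identityʳ _))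
  |w| : length us + length vs ≡ n
  |w| = trans (sym (List.length-++ us)) (trans (↭.↭-length us++vs↭) (List.length-iterate suc k n))
  |w|≤h : length us + length vs ≤ h
  |w|≤h = subst (_≤ h) (sym |w|) n≤h
  avoid : Avoids us × Avoids vs × All (λ x → All (_≤ x) vs) us
  avoid = avoids-++⁻ us (All.++⁻ʳ us (↭.All-resp-↭ (↭-sym us++vs↭) (range-< k n))) w-avoids
  split : us ↭ range (k + length vs) (length us) × vs ↭ range k (length vs)
  split = range-split k us vs (subst (λ j → us ++ vs ↭ range k j) (sym |w|) us++vs↭) (proj₂ (proj₂ avoid))

module _ {a} {A : Set a} where

  -- The elements of `xs` are removed from `ys` one at a time; distinctness ensures that the later
  -- ones survive each removal.
  unique-⊆⇒↭++ : ∀ {xs ys : List A} → List.Unique xs → xs ⊆ ys → ∃ λ zs → ys ↭ xs ++ zs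
  unique-⊆⇒↭++ {[]}     {ys} _ _ = ys , ↭-refl
  unique-⊆⇒↭++ {x ∷ xs} (x∉xs ∷ xs!) xs⊆ys with us , vs , refl ← ∈-∃++ (xs⊆ys (here refl)) =
    let zs , us++vs↭ = unique-⊆⇒↭++ xs! xs⊆us++vs in
    zs , ↭-trans (↭.shift x us vs) (↭-prep x us++vs↭)
    where
    xs⊆us++vs : xs ⊆ us ++ vs
    xs⊆us++vs z∈xs with ∈-++⁻ us (xs⊆ys (there z∈xs))
    ... | inj₁ z∈us         = ∈-++⁺ˡ z∈us
    ... | inj₂ (here refl)  = contradiction refl (All.lookup x∉xs z∈xs)
    ... | inj₂ (there z∈vs) = ∈-++⁺ʳ us z∈vs

  unique-⊆⇒length≤ : ∀ {xs ys : List A} → List.Unique xs → xs ⊆ ys → length xs ≤ length ys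
  unique-⊆⇒length≤ {xs} xs! xs⊆ys = let zs , ys↭ = unique-⊆⇒↭++ xs! xs⊆ys in
    subst (length xs ≤_) (sym (trans (↭.↭-length ys↭) (List.length-++ xs))) (ℕ.m≤m+n _ (length zs))

  unique-⊆⇒↭ : ∀ {xs ys : List A} → List.Unique xs → xs ⊆ ys → length xs ≡ length ys → xs ↭ ys
  unique-⊆⇒↭ {xs} {ys} xs! xs⊆ys |xs|≡|ys| with unique-⊆⇒↭++ xs! xs⊆ys
  ... | []     , ys↭ = ↭-sym (↭-trans ys↭ (↭-reflexive (List.++-identityʳ xs)))
  ... | z ∷ zs , ys↭ = contradiction (trans |xs|≡|ys| (trans (↭.↭-length ys↭) (List.length-++ xs)))
    (ℕ.m≢1+m+n (length xs) ∘ λ eq → trans eq (ℕ.+-suc (length xs) (length zs)))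

-- Permutations as words

module _ {a b} {A : Set a} {B : Set b} where

  ∈-convolve⁻ : ∀ {f : ℕ → List A} {g : ℕ → List B} n {p} → p ∈ convolve f g n →
                ∃ λ i → ∃ λ j → i + j ≡ n × proj₁ p ∈ f i × proj₂ p ∈ g j
  ∈-convolve⁻ {f} {g} zero    p∈ = 0 , 0 , refl , ∈-cartesianProduct⁻ (f 0) (g 0) p∈
  ∈-convolve⁻ {f} {g} (suc n) p∈ with ∈-++⁻ (cartesianProduct (f 0) (g (suc n))) p∈
  ... | inj₁ p∈₀ = 0 , suc n , refl , ∈-cartesianProduct⁻ (f 0) (g (suc n)) p∈₀
  ... | inj₂ p∈₁ = let i , j , i+j≡n , p = ∈-convolve⁻ n p∈₁ in suc i , j , cong suc i+j≡n , p

  ∈-convolve⁺ : ∀ {f : ℕ → List A} {g : ℕ → List B} i j {p q} → p ∈ f i → q ∈ g j → (p , q) ∈ convolve f g (i + j)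
  ∈-convolve⁺ zero    zero    p∈ q∈ = ∈-cartesianProduct⁺ p∈ q∈
  ∈-convolve⁺ zero    (suc j) p∈ q∈ = ∈-++⁺ˡ (∈-cartesianProduct⁺ p∈ q∈)
  ∈-convolve⁺ {f} {g} (suc i) j p∈ q∈ =
    ∈-++⁺ʳ (cartesianProduct (f 0) (g (suc (i + j)))) (∈-convolve⁺ {f ∘ suc} {g} i j p∈ q∈)

  -- Pairs from different summands already differ in their first component, whose index is
  -- determined.
  convolve-unique : ∀ {f : ℕ → List A} {g : ℕ → List B} → (∀ i → List.Unique (f i)) → (∀ j → List.Unique (g j)) →
                    (∀ {i j x} → x ∈ f i → x ∈ f j → i ≡ j) → ∀ n → List.Unique (convolve f g n)
  convolve-unique f! g! f-disjoint zero    = Unique.cartesianProduct⁺ (f! 0) (g! 0)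
  convolve-unique {f} {g} f! g! f-disjoint (suc n) = Unique.++⁺ (Unique.cartesianProduct⁺ (f! 0) (g! (suc n)))
    (convolve-unique (f! ∘ suc) g! (λ x∈ x∈′ → ℕ.suc-injective (f-disjoint x∈ x∈′)) n)
    λ (p∈₀ , p∈₁) → let _ , _ , _ , x∈ , _ = ∈-convolve⁻ {f ∘ suc} n p∈₁ in
      ℕ.0≢1+n (f-disjoint (proj₁ (∈-cartesianProduct⁻ (f 0) (g (suc n)) p∈₀)) x∈)

∈-treesOfSize⁻ : ∀ h n {t} → t ∈ treesOfSize h n → size t ≡ n
∈-treesOfSize⁻ _       zero    (here refl) = refl
∈-treesOfSize⁻ (suc h) (suc n) t∈ with ∈-map⁻ (uncurry node) t∈
... | (l , r) , lr∈ , refl = let i , j , i+j≡n , l∈ , r∈ = ∈-convolve⁻ n lr∈ in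
  cong suc (trans (cong₂ _+_ (∈-treesOfSize⁻ h i l∈) (∈-treesOfSize⁻ h j r∈)) i+j≡n)

∈-treesOfSize⁺ : ∀ {h} t → size t ≤ h → t ∈ treesOfSize h (size t)
∈-treesOfSize⁺ leaf _ = here refl
∈-treesOfSize⁺ (node l r) (s≤s |t|≤h) = ∈-map⁺ (uncurry node) (∈-convolve⁺ (size l) (size r)
  (∈-treesOfSize⁺ l (ℕ.≤-trans (ℕ.m≤m+n _ _) |t|≤h)) (∈-treesOfSize⁺ r (ℕ.≤-trans (ℕ.m≤n+m _ _) |t|≤h)))

treesOfSize-unique : ∀ h n → List.Unique (treesOfSize h n)
treesOfSize-unique _       zero    = [] ∷ []
treesOfSize-unique zero    (suc n) = []
treesOfSize-unique (suc h) (suc n) = Unique.map⁺ (λ { refl → refl })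
  (convolve-unique (treesOfSize-unique h) (treesOfSize-unique h)
    (λ x∈ x∈′ → trans (sym (∈-treesOfSize⁻ h _ x∈)) (∈-treesOfSize⁻ h _ x∈′)) n)

module _ {p} {A : Set} {P : Pred A p} (P? : Decidable P) where

  length-filter-sum : ∀ xs → length (filter P? xs) ≡ sum (map (𝟙 ∘ P?) xs)
  length-filter-sum []       = refl
  length-filter-sum (x ∷ xs) with P? x
  ... | yes _ = cong suc (length-filter-sum xs)
  ... | no  _ = length-filter-sum xs

sum-cartesianProduct : ∀ {A B : Set} (h : A × B → ℕ) xs ys →
  sum (map h (cartesianProduct xs ys)) ≡ sum (map (λ x → sum (map (λ y → h (x , y)) ys)) xs)
sum-cartesianProduct h []       ys = refl
sum-cartesianProduct h (x ∷ xs) ys = begin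
  sum (map h (map (x ,_) ys ++ cartesianProduct xs ys))
    ≡⟨ cong sum (List.map-++ h (map (x ,_) ys) (cartesianProduct xs ys)) ⟩
  sum (map h (map (x ,_) ys) ++ map h (cartesianProduct xs ys))
    ≡⟨ sum-++ (map h (map (x ,_) ys)) _ ⟩
  sum (map h (map (x ,_) ys)) + sum (map h (cartesianProduct xs ys))
    ≡⟨ cong₂ _+_ (cong sum (sym (List.map-∘ ys))) (sum-cartesianProduct h xs ys) ⟩
  sum (map (λ y → h (x , y)) ys) + sum (map (λ x → sum (map (λ y → h (x , y)) ys)) xs) ∎
  where open ≡-Reasoning

sum-allFin : ∀ {n} (h : Fin n → ℕ) → sum (map h (allFin n)) ≡ sum (tabulate h)
sum-allFin h = cong sum (List.map-tabulate id h)

𝟙-cong : ∀ {p q} {P : Set p} {Q : Set q} (P? : Dec P) (Q? : Dec Q) → (P → Q) → (Q → P) → 𝟙 P? ≡ 𝟙 Q?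
𝟙-cong (yes p) Q? f g = sym (𝟙-yes Q? (f p))
𝟙-cong (no ¬p) Q? f g = sym (𝟙-no Q? (¬p ∘ g))

-- Dropping the first letter of a `Word n` leaves no `Word`; functions into ℕ restrict along `suc`,
-- as the inductions on positions require.
Straddle : ∀ {n} → ℕ → (Fin n → ℕ) → Fin n → Set
Straddle x f b = ∃ λ b⁺ → toℕ b⁺ ≡ suc (toℕ b) × f b < x × x < f b⁺

straddle? : ∀ {n} x (f : Fin n → ℕ) → Decidable (Straddle x f)
straddle? x f b = Fin.any? λ b⁺ → toℕ b⁺ ≟ suc (toℕ b) ×-dec f b <? x ×-dec x <? f b⁺

Occurrence : ∀ {n} → (Fin n → ℕ) → Fin n → Fin n → Set
Occurrence f a b = a Fin.< b × Straddle (f a) f b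

occurrence? : ∀ {n} (f : Fin n → ℕ) a → Decidable (Occurrence f a)
occurrence? f a b = a Fin.<? b ×-dec straddle? (f a) f b

sum-tabulate-cong : ∀ {n} {f g : Fin n → ℕ} → f ≗ g → sum (tabulate f) ≡ sum (tabulate g)
sum-tabulate-cong f≗g = cong sum (List.tabulate-cong f≗g)

straddles-tabulate : ∀ {n} x (f : Fin n → ℕ) → sum (tabulate (𝟙 ∘ straddle? x f)) ≡ straddles x (tabulate f)
straddles-tabulate {zero}        x f = refl
straddles-tabulate {suc zero}    x f = cong (_+ 0) (𝟙-no (straddle? x f zero) λ { (zero , () , _) })
straddles-tabulate {suc (suc n)} x f = cong₂ _+_
  (𝟙-cong (straddle? x f zero) (f zero <? x ×-dec x <? f (suc zero))
    (λ { (suc zero , refl , p) → p }) (λ p → suc zero , refl , p))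
  (trans
    (sum-tabulate-cong λ b → 𝟙-cong (straddle? x f (suc b)) (straddle? x (f ∘ suc) b)
      (λ { (suc b⁺ , eq , p) → b⁺ , ℕ.suc-injective eq , p }) (λ (b⁺ , eq , p) → suc b⁺ , cong suc eq , p))
    (straddles-tabulate x (f ∘ suc)))

-- The row of position 0 gives `straddles` of the first letter, the column of position 0 is empty as
-- a < b, and the rest is the same sum for `f ∘ suc`.
occurrences-tabulate : ∀ {n} (f : Fin n → ℕ) →
  sum (tabulate λ a → sum (tabulate λ b → 𝟙 (occurrence? f a b))) ≡ count2-13 (tabulate f)
occurrences-tabulate {zero}  f = refl
occurrences-tabulate {suc n} f = cong₂ _+_
  (cong₂ _+_ (𝟙-no (occurrence? f zero zero) λ { (() , _) })
    (trans
      (sum-tabulate-cong λ b → 𝟙-cong (occurrence? f zero (suc b)) (straddle? (f zero) (f ∘ suc) b)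
        (λ { (_ , suc b⁺ , eq , p) → b⁺ , ℕ.suc-injective eq , p })
        (λ (b⁺ , eq , p) → z<s , suc b⁺ , cong suc eq , p))
      (straddles-tabulate (f zero) (f ∘ suc))))
  (trans
    (sum-tabulate-cong λ a → cong₂ _+_ (𝟙-no (occurrence? f (suc a) zero) λ { (() , _) })
      (sum-tabulate-cong λ b → 𝟙-cong (occurrence? f (suc a) (suc b)) (occurrence? (f ∘ suc) a b)
        (λ { (s≤s a<b , suc b⁺ , eq , p) → a<b , b⁺ , ℕ.suc-injective eq , p })
        (λ (a<b , b⁺ , eq , p) → s≤s a<b , suc b⁺ , cong suc eq , p)))
    (occurrences-tabulate (f ∘ suc)))

letters : ∀ {n} → Word n → List ℕ
letters π = tabulate (toℕ ∘ lookup π)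

occurrences-letters : ∀ {n} (π : Word n) → occurrences2-13 π ≡ count2-13 (letters π)
occurrences-letters {n} π = begin
  occurrences2-13 π
    ≡⟨ length-filter-sum (occurrence2-13? π) (positionPairs n) ⟩
  sum (map (𝟙 ∘ occurrence2-13? π) (positionPairs n))
    ≡⟨ sum-cartesianProduct (𝟙 ∘ occurrence2-13? π) (allFin n) (allFin n) ⟩
  sum (map (λ a → sum (map (λ b → 𝟙 (occurrence2-13? π (a , b))) (allFin n))) (allFin n))
    ≡⟨ sum-allFin (λ a → sum (map (λ b → 𝟙 (occurrence2-13? π (a , b))) (allFin n))) ⟩
  sum (tabulate (λ a → sum (map (λ b → 𝟙 (occurrence2-13? π (a , b))) (allFin n))))
    ≡⟨ sum-tabulate-cong (λ a → trans (sum-allFin (λ b → 𝟙 (occurrence2-13? π (a , b)))) (sum-tabulate-cong λ b →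
         𝟙-cong (occurrence2-13? π (a , b)) (occurrence? (toℕ ∘ lookup π) a b) id id)) ⟩
  sum (tabulate (λ a → sum (tabulate (λ b → 𝟙 (occurrence? (toℕ ∘ lookup π) a b)))))
    ≡⟨ occurrences-tabulate (toℕ ∘ lookup π) ⟩
  count2-13 (letters π) ∎
  where open ≡-Reasoning

allPairs-tabulate⁻ : ∀ {A : Set} {R : A → A → Set} {n} {f : Fin n → A} → AllPairs R (tabulate f) →
                     ∀ {i j} → i Fin.< j → R (f i) (f j)
allPairs-tabulate⁻ (p ∷ _)  {zero}  {suc j} _         = All.tabulate⁻ p j
allPairs-tabulate⁻ (_ ∷ ps) {suc i} {suc j} (s≤s i<j) = allPairs-tabulate⁻ ps i<j

Avoids132ᶠ : ∀ {n} → (Fin n → ℕ) → Set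
Avoids132ᶠ f = ∀ a b c → ¬ (a Fin.< b × b Fin.< c × f a < f c × f c < f b)

avoids-tabulate⁺ : ∀ {n} {f : Fin n → ℕ} → Avoids132ᶠ f → Avoids (tabulate f)
avoids-tabulate⁺ {zero}  _       = tt
avoids-tabulate⁺ {suc n} avoids =
  AllPairs.tabulate⁺-< (λ {b} {c} b<c p → avoids zero (suc b) (suc c) (z<s , s≤s b<c , p)) ,
  avoids-tabulate⁺ λ a b c (a<b , b<c , p) → avoids (suc a) (suc b) (suc c) (s≤s a<b , s≤s b<c , p)

avoids-tabulate⁻ : ∀ {n} {f : Fin n → ℕ} → Avoids (tabulate f) → Avoids132ᶠ f
avoids-tabulate⁻ (f₀-avoids , _) zero (suc b) (suc c) (_ , s≤s b<c , p) = allPairs-tabulate⁻ f₀-avoids b<c p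
avoids-tabulate⁻ (_ , avoids) (suc a) (suc b) (suc c) (s≤s a<b , s≤s b<c , p) =
  avoids-tabulate⁻ avoids a b c (a<b , b<c , p)

tabulate-injective : ∀ {A : Set} {n} {f g : Fin n → A} → tabulate f ≡ tabulate g → f ≗ g
tabulate-injective eq zero    = List.∷-injectiveˡ eq
tabulate-injective eq (suc i) = tabulate-injective (List.∷-injectiveʳ eq) i

letters-injective : ∀ {n} {π ρ : Word n} → letters π ≡ letters ρ → π ≡ ρ
letters-injective {π = π} {ρ} eq = trans (sym (Vec.tabulate∘lookup π))
  (trans (Vec.tabulate-cong (Fin.toℕ-injective ∘ tabulate-injective eq)) (Vec.tabulate∘lookup ρ))

∈-range : ∀ k {i n} → i < n → k + i ∈ range k n
∈-range k {zero}  {suc n} _         = here (ℕ.+-identityʳ k)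
∈-range k {suc i} {suc n} (s≤s i<n) = there (subst (_∈ range (suc k) n) (sym (ℕ.+-suc k i)) (∈-range (suc k) i<n))

-- Pigeonhole: n distinct letters below n exhaust the range.
letters-↭ : ∀ {n} {π : Word n} → Unique π → letters π ↭ range 0 n
letters-↭ {n} {π} π! = unique-⊆⇒↭
  (Unique.tabulate⁺ λ {i} {j} eq → VecUnique.lookup-injective π! i j (Fin.toℕ-injective eq))
  (λ z∈ → let i , z≡ = ∈-tabulate⁻ z∈ in subst (_∈ range 0 n) (sym z≡) (∈-range 0 (Fin.toℕ<n (lookup π i))))
  (trans (List.length-tabulate (toℕ ∘ lookup π)) (sym (List.length-iterate suc 0 n)))

letters-surjective : ∀ {n} w → length w ≡ n → All (_< n) w → List.Unique w →
                     ∃ λ (π : Word n) → letters π ≡ w × Unique π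
letters-surjective w refl w<n w! = Vec.tabulate g , letters≡w , VecUnique.tabulate⁺ g-injective
  where
  bound : ∀ i → List.lookup w i < length w
  bound i = All.lookup w<n (∈-lookup i)
  g : Fin (length w) → Fin (length w)
  g i = fromℕ< (bound i)
  letters≡w : letters (Vec.tabulate g) ≡ w
  letters≡w = trans
    (List.tabulate-cong λ i → trans (cong toℕ (Vec.lookup∘tabulate g i)) (Fin.toℕ-fromℕ< (bound i)))
    (List.tabulate-lookup w)
  distinct : ∀ {i j} → i Fin.< j → List.lookup w i ≢ List.lookup w j
  distinct = allPairs-tabulate⁻ (subst List.Unique (sym (List.tabulate-lookup w)) w!)
  g-injective : ∀ {i j} → g i ≡ g j → i ≡ j
  g-injective {i} {j} eq with Fin.<-cmp i j
  ... | tri≈ _ i≡j _ = i≡j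
  ... | tri< i<j _ _ = contradiction (Fin.fromℕ<-injective _ _ (bound i) (bound j) eq) (distinct i<j)
  ... | tri> _ _ j<i = contradiction (sym (Fin.fromℕ<-injective _ _ (bound i) (bound j) eq)) (distinct j<i)

-- Equal numbers of permutations and trees

∈-allVecs : ∀ {k n} (v : Vec (Fin k) n) → v ∈ allVecs k n
∈-allVecs Vec.[]      = here refl
∈-allVecs (i Vec.∷ v) = ∈-cartesianProductWith⁺ Vec._∷_ (∈-allFin i) (∈-allVecs v)

allVecs-unique : ∀ k n → List.Unique (allVecs k n)
allVecs-unique k zero    = [] ∷ []
allVecs-unique k (suc n) =
  Unique.cartesianProductWith⁺ Vec._∷_ Vec.∷-injective (Unique.allFin⁺ k) (allVecs-unique k n)

-- Permutations and trees are both mapped injectively to lists of naturals; the two resulting lists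
-- have no repetitions and contain each other, so their lengths agree.
f₂₋₁₃-trees : ∀ r n → f₂₋₁₃ r n ≡ length (filter (λ t → occurrences t ≟ r) (trees n))
f₂₋₁₃-trees r n = ℕ.≤-antisym
  (subst₂ _≤_ (List.length-map letters πs) (List.length-map (word 0) ts)
    (unique-⊆⇒length≤ πs! (λ w∈ → let π , π∈ , w≡ = ∈-map⁻ letters w∈ in subst (_∈ _) (sym w≡) (to π∈))))
  (subst₂ _≤_ (List.length-map (word 0) ts) (List.length-map letters πs)
    (unique-⊆⇒length≤ ts! (λ w∈ → let t , t∈ , w≡ = ∈-map⁻ (word 0) w∈ in subst (_∈ _) (sym w≡) (from t∈))))
  where
  counted? : Decidable λ π → Avoids132 π × occurrences2-13 π ≡ r
  counted? π = avoids132? π ×-dec occurrences2-13 π ≟ r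
  πs = filter counted? (S n)
  ts = filter (λ t → occurrences t ≟ r) (trees n)
  πs! : List.Unique (map letters πs)
  πs! = Unique.map⁺ letters-injective (Unique.filter⁺ counted? (Unique.filter⁺ unique? (allVecs-unique n n)))
  ts! : List.Unique (map (word 0) ts)
  ts! = Unique.map⁺ (word-injective 0 _ _) (Unique.filter⁺ _ (treesOfSize-unique n n))
  to : ∀ {π} → π ∈ πs → letters π ∈ map (word 0) ts
  to {π} π∈ =
    let π∈S , avoids , occ≡r = ∈-filter⁻ counted? {xs = S n} π∈
        _ , π!               = ∈-filter⁻ unique? {xs = allVecs n n} π∈S
        t , |t|≡n , word≡    = parse n ℕ.≤-refl (letters-↭ π!) (avoids-tabulate⁺ avoids)
        t∈                   = subst (λ m → t ∈ treesOfSize n m) |t|≡n (∈-treesOfSize⁺ t (ℕ.≤-reflexive |t|≡n))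
        occ-t≡r              = trans (sym (count2-13-word 0 t))
                                 (trans (cong count2-13 word≡) (trans (sym (occurrences-letters π)) occ≡r))
    in subst (_∈ map (word 0) ts) word≡ (∈-map⁺ (word 0) (∈-filter⁺ _ t∈ occ-t≡r))
  from : ∀ {t} → t ∈ ts → word 0 t ∈ map letters πs
  from {t} t∈ =
    let t∈trees , occ≡r = ∈-filter⁻ (λ t → occurrences t ≟ r) {xs = trees n} t∈
        |t|≡n           = ∈-treesOfSize⁻ n n t∈trees
        π , letters≡ , π! = letters-surjective (word 0 t) (trans (length-word 0 t) |t|≡n)
          (subst (λ m → All (_< m) (word 0 t)) |t|≡n (word-< 0 t)) (word-unique 0 t)
        avoids          = avoids-tabulate⁻ (subst Avoids (sym letters≡) (word-avoids 0 t))
        occ-π≡r         = trans (occurrences-letters π)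
          (trans (cong count2-13 letters≡) (trans (count2-13-word 0 t) occ≡r))
    in subst (_∈ map letters πs) letters≡
         (∈-map⁺ letters (∈-filter⁺ counted? (∈-filter⁺ unique? (∈-allVecs π) π!) (avoids , occ-π≡r)))

-- Coefficients in y and conclusion

coeff-y^ : ∀ m r → coeff (y ^ m) r ≡ ℤ.+ 𝟙 (m ≟ r)
coeff-y^ zero    zero    = refl
coeff-y^ zero    (suc r) = refl
coeff-y^ (suc m) zero    = ℤ.*-zeroˡ (coeff (y ^ m) 0)
coeff-y^ (suc m) (suc r) = trans (SeriesRing.X-* ℤ.+-*-commutativeRing (coeff (y ^ m)) r) (coeff-y^ m r)

open ListSum ℤ[y]-commutativeRing using (∑)

-- Turns the tree series, a sum of powers of y, into the counts by which `F₂₋₁₃` is defined.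
coeff-∑-y^ : ∀ {A : Set} (h : A → ℕ) xs r → coeff (∑ (λ x → y ^ h x) xs) r ≡ ℤ.+ length (filter (λ x → h x ≟ r) xs)
coeff-∑-y^ h xs r = trans (coeff-sum xs) (cong ℤ.+_ (sym (length-filter-sum (λ x → h x ≟ r) xs)))
  where
  coeff-sum : ∀ xs → coeff (∑ (λ x → y ^ h x) xs) r ≡ ℤ.+ sum (map (λ x → 𝟙 (h x ≟ r)) xs)
  coeff-sum []       = constant-0 r
  coeff-sum (x ∷ xs) = cong₂ ℤ._+_ (coeff-y^ (h x) r) (coeff-sum xs)

open TreeSeries ℤ[y]-commutativeRing y using (fraction-⟶𝔽)

theorem4p5 : truncatedFraction numerator ⟶ F₂₋₁₃
theorem4p5 N = let M , agree = fraction-⟶𝔽 N in M , λ m M≤m n n<N r →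
  trans (agree m M≤m n n<N r) (trans (coeff-∑-y^ occurrences (trees n) r) (cong ℤ.+_ (sym (f₂₋₁₃-trees r n))))
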